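{- Let $m$ and $n$ be nonnegative integers with the same parity, and let $l$ be a nonnegative integer. Let $A$ and $B$ be $m \times m$ and $n \times n$ skew-symmetric matrices, and let $S$ and $T$ be $m \times l$ and $n \times l$ matrices. Then $$ \sum_K (-1)^{ \binom{\# K}{2} } \operatorname{Pf} \begin{pmatrix} A & S([m];K) \\ -{}^t S([m];K) & O \end{pmatrix} \operatorname{Pf} \begin{pmatrix} B & T([n];K) \\ -{}^t T([n];K) & O \end{pmatrix} = \operatorname{Pf} \begin{pmatrix} A & S\, {}^t T \\ - T\, {}^t S & B \end{pmatrix} $$ and $$ \sum_K \operatorname{Pf} \begin{pmatrix} A & S([m];K) \\ -{}^t S([m];K) & O \end{pmatrix} \operatorname{Pf} \begin{pmatrix} B & T([n];K) \\ -{}^t T([n];K) & O \end{pmatrix} = (-1)^{ \binom{n}{2} } \operatorname{Pf} \begin{pmatrix} A & S\, {}^t T \\ - T\, {}^t S & -B \end{pmatrix}, $$ where in both sums $K$ runs over all subsets of $[l]$ with $\# K \equiv m \equiv n \bmod 2$.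
   Context: All matrices have entries in a fixed commutative ring; skew-symmetric means ${}^tX=-X$ with zero diagonal, where ${}^tX$ is the transpose. For a skew-symmetric matrix $X=(x_{ij})_{1\le i,j\le 2r}$ of even order, the Pfaffian is $$\operatorname{Pf}(X)=\sum_{\sigma\in F_{2r}}\operatorname{sgn}(\sigma)\prod_{i=1}^r x_{\sigma(2i-1),\sigma(2i)},$$ where $F_{2r}$ is the set of permutations $\sigma\in S_{2r}$ with $\sigma(1)<\sigma(3)<\dots<\sigma(2r-1)$ and $\sigma(2i-1)<\sigma(2i)$ for $1\le i\le r$. The Pfaffian of the empty ($0\times 0$) matrix is $1$. We write $[n]=\{1,2,\dots,n\}$. For an $M\times N$ matrix $X$ and subsets $I\subset[M]$, $J\subset[N]$, $X(I;J)$ denotes the submatrix of $X$ with rows indexed by $I$ and columns indexed by $J$ (in increasing order). $O$ denotes a zero matrix of the appropriate size, and $\#K$ is the cardinality of $K$. -}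

module Defs where

open import Level using (Level)
open import Algebra.Bundles using (CommutativeRing)
import Algebra.Properties.Monoid.Sum as MonoidSum
import Algebra.Properties.Semiring.Exp as SemiringExp
open import Data.Nat.Base as ℕ using (ℕ; zero; suc)
open import Data.Nat.Divisibility using (_∣?_; divides)
import Data.Nat.Properties as ℕ
open import Data.Fin.Base as Fin using (Fin; zero; suc; combine)
import Data.Fin.Properties as Fin
open import Data.Fin.Permutation as Perm using (Permutation′; _⟨$⟩ʳ_)
open import Data.Fin.Subset using (Subset; inside; outside; ∣_∣)
open import Data.List.Base as List using (List; []; _∷_)
open import Data.Product.Base using (_×_; _,_)
open import Data.Vec.Base as Vec using ([]; _∷_)
open import Data.Vec.Functional as Vector using (Vector; _++_; zipWith; transpose)
open import Relation.Binary.PropositionalEquality using (_≡_; refl)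
open import Relation.Nullary.Decidable using (Dec; yes; no; _×-dec_; _→-dec_)

private
  variable
    n : ℕ

-- Each permutation of Fin (suc n) arises exactly once: σ is
-- insert zero (σ 0) (remove zero σ).
permutations : ∀ n → List (Permutation′ n)
permutations zero    = Perm.id ∷ []
permutations (suc n) =
  List.cartesianProductWith (Perm.insert zero) (List.allFin (suc n)) (permutations n)

Inversion : Permutation′ n → Fin n × Fin n → Set
Inversion σ (i , j) = i Fin.< j × σ ⟨$⟩ʳ j Fin.< σ ⟨$⟩ʳ i

inversion? : (σ : Permutation′ n) → ∀ p → Dec (Inversion σ p)
inversion? σ (i , j) = (i Fin.<? j) ×-dec (σ ⟨$⟩ʳ j Fin.<? σ ⟨$⟩ʳ i)

inversions : Permutation′ n → ℕ
inversions {n} σ =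
  List.length (List.filter (inversion? σ) (List.cartesianProduct (List.allFin n) (List.allFin n)))

-- With indices counted from 0, the i-th pair of positions is (2i , 2i+1).
fstPos sndPos : ∀ {r} → Fin r → Fin (r ℕ.* 2)
fstPos i = combine i zero
sndPos i = combine i (suc zero)

-- Membership in F₂ᵣ.  The chain σ(1) < σ(3) < ⋯ < σ(2r-1) is written as
-- strict monotonicity of the first entries of the pairs.
InF : ∀ r → Permutation′ (r ℕ.* 2) → Set
InF r σ =
  (∀ (i j : Fin r) → i Fin.< j → σ ⟨$⟩ʳ fstPos i Fin.< σ ⟨$⟩ʳ fstPos j) ×
  (∀ (i : Fin r) → σ ⟨$⟩ʳ fstPos i Fin.< σ ⟨$⟩ʳ sndPos i)

inF? : ∀ r σ → Dec (InF r σ)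
inF? r σ =
  Fin.all? (λ i → Fin.all? λ j →
    (i Fin.<? j) →-dec (σ ⟨$⟩ʳ fstPos i Fin.<? σ ⟨$⟩ʳ fstPos j)) ×-dec
  Fin.all? (λ i → σ ⟨$⟩ʳ fstPos i Fin.<? σ ⟨$⟩ʳ sndPos i)

subsets : ∀ l → List (Subset l)
subsets zero    = [] ∷ []
subsets (suc l) = List.map (outside ∷_) (subsets l) List.++ List.map (inside ∷_) (subsets l)

subsetsOfParity : ∀ l → ℕ → List (Subset l)
subsetsOfParity l m = List.filter (λ K → ∣ K ∣ ℕ.% 2 ℕ.≟ m ℕ.% 2) (subsets l)

-- The increasing enumeration of the elements of K.
element : ∀ {l} (K : Subset l) → Fin ∣ K ∣ → Fin l
element (outside ∷ K) i       = suc (element K i)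
element (inside  ∷ K) zero    = zero
element (inside  ∷ K) (suc i) = suc (element K i)

module Pfaffians {c ℓ : Level} (R : CommutativeRing c ℓ) where
  open CommutativeRing R hiding (refl)
  open MonoidSum +-monoid public using (sum)
  open MonoidSum *-monoid public using () renaming (sum to product)
  open SemiringExp semiring public using (_^_)

  Matrix : ℕ → ℕ → Set c
  Matrix m n = Vector (Vector Carrier n) m

  IsSkewSymmetric : Matrix n n → Set ℓ
  IsSkewSymmetric X = (∀ i j → transpose X i j ≈ - X i j) × (∀ i → X i i ≈ 0#)

  O : ∀ {m n} → Matrix m n
  O _ _ = 0#

  infix 8 ⊝_
  ⊝_ : ∀ {m n} → Matrix m n → Matrix m n
  (⊝ X) i j = - X i j

  infixl 7 _⊛_
  _⊛_ : ∀ {m k n} → Matrix m k → Matrix k n → Matrix m n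
  (X ⊛ Y) i j = sum (λ k → X i k * Y k j)

  -- X([m]; K), with the columns in increasing order.
  columns : ∀ {m l} → Matrix m l → (K : Subset l) → Matrix m ∣ K ∣
  columns X K i j = X i (element K j)

  -- block X Y Z W has rows of blocks (X Y) and (Z W).
  block : ∀ {m n p q} → Matrix m p → Matrix m q → Matrix n p → Matrix n q →
          Matrix (m ℕ.+ n) (p ℕ.+ q)
  block X Y Z W = zipWith _++_ X Y ++ zipWith _++_ Z W

  sumOver : ∀ {a} {A : Set a} → List A → (A → Carrier) → Carrier
  sumOver xs f = List.foldr _+_ 0# (List.map f xs)

  sgn : Permutation′ n → Carrier
  sgn σ = (- 1#) ^ inversions σ

  pfaffian : ∀ r → Matrix (r ℕ.* 2) (r ℕ.* 2) → Carrier
  pfaffian r X =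
    sumOver (List.filter (inF? r) (permutations (r ℕ.* 2))) λ σ →
      sgn σ * product (λ (i : Fin r) → X (σ ⟨$⟩ʳ fstPos i) (σ ⟨$⟩ʳ sndPos i))

  -- The order of a block matrix is not syntactically of the form r * 2, hence
  -- this version for any order; the value 0 for odd orders is a convention.
  Pf : Matrix n n → Carrier
  Pf {n} X with 2 ∣? n
  ... | yes (divides r refl) = pfaffian r X
  ... | no  _                = 0#

{-
The Pfaffian is treated as a function pf a on words over an alphabet carrying a
skew form a, defined by expansion along the first letter: pf a (x ∷ w) is the
contraction of pf a by the covector a x.  Contractions anticommute and square to
zero; hence pf a alternates, and pf (a + u ∧ v) = pf a + contract u (contract v (pf a)).

Both identities are instances, for e = 1 and e = -1, of
  Σ_K (-e)^C(#K,2) Pf(A S_K; · O) Pf(B T_K; · O) = e^C(n,2) Pf(A S ᵗT; · eB),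
proved by induction on l with A and B replaced by arbitrary words.  The subsets K
containing the first column are handled by appending that column of S and of T as
letters c₀, d₀ to the two words.  Removing the column from S ᵗT changes the form on
the right by u ∧ v, where u and v are, up to sign, the covectors of c₀ and d₀, so
the extra term is again the Pfaffian of the word with c₀ and d₀ adjoined.
-}
module Submission where

open import Defs
open import Algebra.Bundles using (Monoid; CommutativeRing)
import Algebra.Properties.CommutativeMonoid.Sum as CommutativeMonoidSum
import Algebra.Properties.CommutativeSemiring.Exp as CommutativeSemiringExp
import Algebra.Properties.Monoid.Sum as MonoidSum
import Algebra.Properties.Ring as RingProperties
import Algebra.Solver.Ring.NaturalCoefficients.Default as SemiringSolver
open import Data.Bool.Base using (true; false; if_then_else_)
open import Data.Fin.Base as Fin using (Fin; zero; suc; toℕ; punchIn; splitAt)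
open import Data.Fin.Permutation as Perm using (Permutation′; _⟨$⟩ʳ_; _⟨$⟩ˡ_)
import Data.Fin.Properties as Fin
open import Data.Fin.Subset using (Subset; inside; outside; ∣_∣)
open import Data.List.Base as List
  using (List; []; _∷_; _++_; length; map; tabulate; filter; allFin)
import Data.List.Properties as List
open import Data.Nat.Base as ℕ using (ℕ; zero; suc; s≤s; z<s; s<s; s<s⁻¹; _%_)
open import Data.Nat.Combinatorics using (_C_; nC1≡n; nCk+nC[k+1]≡[n+1]C[k+1])
open import Data.Nat.Divisibility using (_∣?_; divides)
import Data.Nat.DivMod as ℕ
import Data.Nat.Properties as ℕ
open import Data.Product.Base using (_×_; _,_; ∃; proj₁; proj₂)
open import Data.Sum.Base as Sum using (_⊎_; inj₁; inj₂; [_,_]′)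
open import Data.Vec.Base using () renaming (_∷_ to _∷ᵥ_)
open import Data.Vec.Functional using (Vector; transpose)
open import Function.Base using (_∘_; id)
open import Function.Bundles using (_⇔_; mk⇔)
open import Level using (Level)
open import Relation.Binary.PropositionalEquality as ≡ using (_≡_; _≢_)
open import Relation.Nullary.Decidable using (Dec; yes; no; does; does-⇔; dec-false)
open import Relation.Nullary.Negation using (¬_; contradiction)
open import Relation.Unary using (Pred; Decidable)

-- Parity, binomial coefficients and tabulated lists

even⊎odd : ∀ n → (∃ λ k → n ≡ k ℕ.* 2) ⊎ (∃ λ k → n ≡ suc (k ℕ.* 2))
even⊎odd zero = inj₁ (0 , ≡.refl)
even⊎odd (suc n) with even⊎odd n
... | inj₁ (k , n≡2k)   = inj₂ (k , ≡.cong suc n≡2k)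
... | inj₂ (k , n≡1+2k) = inj₁ (suc k , ≡.cong suc n≡1+2k)

%2-cases : ∀ m n → n % 2 ≢ m % 2 → ∃ λ k → m ℕ.+ n ≡ suc (k ℕ.* 2)
%2-cases m n n≢m with even⊎odd m | even⊎odd n
... | inj₁ (i , ≡.refl) | inj₁ (j , ≡.refl) =
  contradiction (≡.trans (ℕ.m*n%n≡0 j 2) (≡.sym (ℕ.m*n%n≡0 i 2))) n≢m
... | inj₁ (i , ≡.refl) | inj₂ (j , ≡.refl) =
  i ℕ.+ j , ≡.trans (ℕ.+-suc (i ℕ.* 2) _) (≡.cong suc (≡.sym (ℕ.*-distribʳ-+ 2 i j)))
... | inj₂ (i , ≡.refl) | inj₁ (j , ≡.refl) = i ℕ.+ j , ≡.cong suc (≡.sym (ℕ.*-distribʳ-+ 2 i j))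
... | inj₂ (i , ≡.refl) | inj₂ (j , ≡.refl) =
  contradiction (≡.trans (ℕ.[m+kn]%n≡m%n 1 j 2) (≡.sym (ℕ.[m+kn]%n≡m%n 1 i 2))) n≢m

[1+n]C2≡nC2+n : ∀ n → suc n C 2 ≡ n C 2 ℕ.+ n
[1+n]C2≡nC2+n n = begin
  suc n C 2         ≡⟨ nCk+nC[k+1]≡[n+1]C[k+1] n 1 ⟨
  n C 1 ℕ.+ n C 2   ≡⟨ ≡.cong (ℕ._+ n C 2) (nC1≡n n) ⟩
  n ℕ.+ n C 2       ≡⟨ ℕ.+-comm n _ ⟩
  n C 2 ℕ.+ n       ∎
  where open ≡.≡-Reasoning

tabulate-splitAt : ∀ {a} {A : Set a} m {n} (f : Fin m → A) (g : Fin n → A) →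
                   tabulate ([ f , g ]′ ∘ splitAt m) ≡ tabulate f ++ tabulate g
tabulate-splitAt zero    f g = ≡.refl
tabulate-splitAt (suc m) f g = ≡.cong (f zero ∷_) (≡.trans
  (List.tabulate-cong λ i → suc-case (splitAt m i)) (tabulate-splitAt m (f ∘ suc) g))
  where
  suc-case : ∀ x → [ f , g ]′ (Sum.map suc id x) ≡ [ f ∘ suc , g ]′ x
  suc-case (inj₁ _) = ≡.refl
  suc-case (inj₂ _) = ≡.refl

-- Sums over lists in a monoid

module ListSum {c ℓ} (M : Monoid c ℓ) where
  open Monoid M
  open MonoidSum M using (sum)

  private
    variable
      a p : Level
      A B C : Set a

  ∑ : List A → (A → Carrier) → Carrier
  ∑ xs f = List.foldr _∙_ ε (map f xs)

  ∑-cong : ∀ (xs : List A) {f g} → (∀ x → f x ≈ g x) → ∑ xs f ≈ ∑ xs g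
  ∑-cong []       f≈g = refl
  ∑-cong (x ∷ xs) f≈g = ∙-cong (f≈g x) (∑-cong xs f≈g)

  ∑-ε : ∀ (xs : List A) {f} → (∀ x → f x ≈ ε) → ∑ xs f ≈ ε
  ∑-ε []       f≈ε = refl
  ∑-ε (x ∷ xs) f≈ε = trans (∙-cong (f≈ε x) (∑-ε xs f≈ε)) (identityˡ ε)

  ∑-++ : ∀ (xs ys : List A) f → ∑ (xs ++ ys) f ≈ ∑ xs f ∙ ∑ ys f
  ∑-++ []       ys f = sym (identityˡ _)
  ∑-++ (x ∷ xs) ys f = trans (∙-congˡ (∑-++ xs ys f)) (sym (assoc _ _ _))

  ∑-map : ∀ (g : A → B) xs f → ∑ (map g xs) f ≡ ∑ xs (f ∘ g)
  ∑-map g xs f = ≡.cong (List.foldr _∙_ ε) (≡.sym (List.map-∘ xs))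

  ∑-cartesianProductWith : ∀ (g : A → B → C) xs ys f →
    ∑ (List.cartesianProductWith g xs ys) f ≈ ∑ xs (λ x → ∑ ys (λ y → f (g x y)))
  ∑-cartesianProductWith g []       ys f = refl
  ∑-cartesianProductWith g (x ∷ xs) ys f = trans (∑-++ (map (g x) ys) _ f)
    (∙-cong (reflexive (∑-map (g x) ys f)) (∑-cartesianProductWith g xs ys f))

  ∑-tabulate : ∀ {n} (g : Fin n → A) f → ∑ (tabulate g) f ≡ sum (f ∘ g)
  ∑-tabulate {n = zero}  g f = ≡.refl
  ∑-tabulate {n = suc n} g f = ≡.cong (f (g zero) ∙_) (∑-tabulate (g ∘ suc) f)

  ∑-allFin : ∀ n f → ∑ (allFin n) f ≡ sum f
  ∑-allFin n f = ∑-tabulate {n = n} id f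

  when : {P : Set p} → Dec P → Carrier → Carrier
  when P? x = if does P? then x else ε

  when-⇔ : ∀ {p q} {P : Set p} {Q : Set q} → P ⇔ Q → (P? : Dec P) (Q? : Dec Q) → ∀ x →
           when P? x ≡ when Q? x
  when-⇔ P⇔Q P? Q? x = ≡.cong (if_then x else ε) (does-⇔ P⇔Q P? Q?)

  when-¬ : {P : Set p} (P? : Dec P) → ¬ P → ∀ x → when P? x ≡ ε
  when-¬ P? ¬P x = ≡.cong (if_then x else ε) (dec-false P? ¬P)

  ∑-filter : ∀ {P : Pred A p} (P? : Decidable P) xs f →
             ∑ (filter P? xs) f ≈ ∑ xs (λ x → when (P? x) (f x))
  ∑-filter P? []       f = refl
  ∑-filter P? (x ∷ xs) f with does (P? x)
  ... | true  = ∙-congˡ (∑-filter P? xs f)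
  ... | false = trans (∑-filter P? xs f) (sym (identityˡ _))

-- The expansion of F₂ᵣ along σ(1), σ(2)

open CommutativeMonoidSum ℕ.+-0-commutativeMonoid using ()
  renaming (sum to sumℕ; sum-cong-≗ to sumℕ-cong; sum-permute to sumℕ-permute;
            sum-replicate-zero to sumℕ-zero)
open ListSum ℕ.+-0-monoid using ()
  renaming (∑ to ∑ℕ; when to whenℕ; when-⇔ to whenℕ-⇔; when-¬ to whenℕ-¬;
            ∑-filter to ∑ℕ-filter; ∑-allFin to ∑ℕ-allFin; ∑-cong to ∑ℕ-cong;
            ∑-cartesianProductWith to ∑ℕ-cartesianProductWith)

length≡∑1 : ∀ {a} {A : Set a} (xs : List A) → length xs ≡ ∑ℕ xs (λ _ → 1)
length≡∑1 []       = ≡.refl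
length≡∑1 (x ∷ xs) = ≡.cong suc (length≡∑1 xs)

punchIn-mono-< : ∀ {n} i (j k : Fin n) → j Fin.< k → punchIn i j Fin.< punchIn i k
punchIn-mono-< i j k j<k = ℕ.≰⇒> λ p → ℕ.<⇒≱ j<k (Fin.punchIn-cancel-≤ i k j p)

punchIn-cancel-< : ∀ {n} i (j k : Fin n) → punchIn i j Fin.< punchIn i k → j Fin.< k
punchIn-cancel-< i j k p = ℕ.≰⇒> λ k≤j → ℕ.<⇒≱ p (Fin.punchIn-mono-≤ i k j k≤j)

inversions-sum : ∀ {n} (σ : Permutation′ n) →
                 inversions σ ≡ sumℕ (λ i → sumℕ (λ j → whenℕ (inversion? σ (i , j)) 1))
inversions-sum {n} σ = begin
  length (filter (inversion? σ) pairs)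
    ≡⟨ length≡∑1 (filter (inversion? σ) pairs) ⟩
  ∑ℕ (filter (inversion? σ) pairs) (λ _ → 1)
    ≡⟨ ∑ℕ-filter (inversion? σ) pairs _ ⟩
  ∑ℕ pairs (λ p → whenℕ (inversion? σ p) 1)
    ≡⟨ ∑ℕ-cartesianProductWith _,_ (allFin n) (allFin n) _ ⟩
  ∑ℕ (allFin n) (λ i → ∑ℕ (allFin n) (λ j → whenℕ (inversion? σ (i , j)) 1))
    ≡⟨ ∑ℕ-cong (allFin n) (λ i → ∑ℕ-allFin n (λ j → whenℕ (inversion? σ (i , j)) 1)) ⟩
  ∑ℕ (allFin n) (λ i → sumℕ (λ j → whenℕ (inversion? σ (i , j)) 1))
    ≡⟨ ∑ℕ-allFin n (λ i → sumℕ (λ j → whenℕ (inversion? σ (i , j)) 1)) ⟩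
  sumℕ (λ i → sumℕ (λ j → whenℕ (inversion? σ (i , j)) 1)) ∎
  where
  open ≡.≡-Reasoning
  pairs = List.cartesianProduct (allFin n) (allFin n)

-- `punchIn j` lists the values other than `j` in order, and exactly `toℕ j` of them lie below `j`.
count-punchIn-< : ∀ {n} (j : Fin (suc n)) →
                  sumℕ (λ y → whenℕ (punchIn j y Fin.<? j) 1) ≡ toℕ j
count-punchIn-< {n}     zero    = sumℕ-zero n
count-punchIn-< {suc n} (suc j) = ≡.cong suc (≡.trans
  (sumℕ-cong λ y → whenℕ-⇔ (mk⇔ s<s⁻¹ s<s)
    (punchIn (suc j) (suc y) Fin.<? suc j) (punchIn j y Fin.<? j) 1)
  (count-punchIn-< j))

-- The new first position, with value `j`, is inverted with each of the `toℕ j` smaller values. All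
-- other pairs compare as in `π`, because `punchIn j` preserves and reflects the order.
inversions-insert : ∀ {n} (j : Fin (suc n)) (π : Permutation′ n) →
                    inversions (Perm.insert zero j π) ≡ toℕ j ℕ.+ inversions π
inversions-insert {n} j π = begin
  inversions σ
    ≡⟨ inversions-sum σ ⟩
  sumℕ (λ k → whenℕ (inversion? σ (zero , suc k)) 1)
    ℕ.+ sumℕ (λ i → whenℕ (inversion? σ (suc i , zero)) 1
                ℕ.+ sumℕ (λ k → whenℕ (inversion? σ (suc i , suc k)) 1))
    ≡⟨ ≡.cong₂ ℕ._+_ (sumℕ-cong first-row) (sumℕ-cong λ i → ≡.cong₂ ℕ._+_
         (whenℕ-¬ (inversion? σ (suc i , zero)) (λ ()) 1) (sumℕ-cong (other-rows i))) ⟩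
  sumℕ (λ k → whenℕ (punchIn j (π ⟨$⟩ʳ k) Fin.<? j) 1)
    ℕ.+ sumℕ (λ i → sumℕ (λ k → whenℕ (inversion? π (i , k)) 1))
    -- The first row depends on `k` only through `π ⟨$⟩ʳ k`, so it can be summed over values instead
    -- of positions.
    ≡⟨ ≡.cong₂ ℕ._+_ (sumℕ-permute (λ y → whenℕ (punchIn j y Fin.<? j) 1) π) (inversions-sum π) ⟨
  sumℕ (λ y → whenℕ (punchIn j y Fin.<? j) 1) ℕ.+ inversions π
    ≡⟨ ≡.cong (ℕ._+ inversions π) (count-punchIn-< j) ⟩
  toℕ j ℕ.+ inversions π ∎
  where
  open ≡.≡-Reasoning
  σ = Perm.insert zero j π

  first-row : ∀ k → whenℕ (inversion? σ (zero , suc k)) 1 ≡ whenℕ (punchIn j (π ⟨$⟩ʳ k) Fin.<? j) 1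
  first-row k = whenℕ-⇔ (mk⇔ proj₂ (z<s ,_)) (inversion? σ (zero , suc k)) (_ Fin.<? j) 1

  other-rows : ∀ i k → whenℕ (inversion? σ (suc i , suc k)) 1 ≡ whenℕ (inversion? π (i , k)) 1
  other-rows i k = whenℕ-⇔
    (mk⇔ (λ (p , q) → s<s⁻¹ p , punchIn-cancel-< j _ _ q)
         (λ (p , q) → s<s p , punchIn-mono-< j _ _ q))
    (inversion? σ (suc i , suc k)) (inversion? π (i , k)) 1

-- The value 0 sits somewhere. As a second entry, or as the first entry of a later pair, it would
-- have to exceed another value.
InF⇒σ0≡0 : ∀ {r} (σ : Permutation′ (suc r ℕ.* 2)) → InF (suc r) σ → σ ⟨$⟩ʳ zero ≡ zero
InF⇒σ0≡0 {r} σ (fst-mono , fst<snd)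
  with Fin.combine-surjective {suc r} {2} (σ ⟨$⟩ˡ zero)
... | zero  , zero     , p = ≡.trans (≡.cong (σ ⟨$⟩ʳ_) p) (Perm.inverseʳ σ)
... | suc i , zero     , p =
  contradiction (≡.subst (σ ⟨$⟩ʳ zero Fin.<_) σ[fst]≡0 (fst-mono zero (suc i) z<s)) λ ()
  where σ[fst]≡0 = ≡.trans (≡.cong (σ ⟨$⟩ʳ_) p) (Perm.inverseʳ σ)
... | i     , suc zero , p =
  contradiction (≡.subst (σ ⟨$⟩ʳ fstPos i Fin.<_) σ[snd]≡0 (fst<snd i)) λ ()
  where σ[snd]≡0 = ≡.trans (≡.cong (σ ⟨$⟩ʳ_) p) (Perm.inverseʳ σ)

-- The first pair has values `zero` and `suc k`; conditions involving it hold because its first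
-- entry is the least value. The remaining entries are those of `π` under an order embedding.
InF-insert : ∀ {r} (k : Fin (suc (r ℕ.* 2))) (π : Permutation′ (r ℕ.* 2)) →
             InF (suc r) (Perm.insert zero zero (Perm.insert zero k π)) ⇔ InF r π
InF-insert {r} k π = mk⇔ to from
  where
  σ = Perm.insert zero zero (Perm.insert zero k π)

  to : InF (suc r) σ → InF r π
  to (fst-mono , fst<snd) =
    (λ i j i<j → punchIn-cancel-< k _ _ (s<s⁻¹ (fst-mono (suc i) (suc j) (s<s i<j)))) ,
    (λ i → punchIn-cancel-< k _ _ (s<s⁻¹ (fst<snd (suc i))))

  from : InF r π → InF (suc r) σ
  from (fst-mono , fst<snd) = fst-mono′ , fst<snd′
    where
    fst-mono′ : ∀ i j → i Fin.< j → σ ⟨$⟩ʳ fstPos i Fin.< σ ⟨$⟩ʳ fstPos j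
    fst-mono′ zero    (suc j) _   = z<s
    fst-mono′ (suc i) (suc j) i<j = s<s (punchIn-mono-< k _ _ (fst-mono i j (s<s⁻¹ i<j)))

    fst<snd′ : ∀ i → σ ⟨$⟩ʳ fstPos i Fin.< σ ⟨$⟩ʳ sndPos i
    fst<snd′ zero    = z<s
    fst<snd′ (suc i) = s<s (punchIn-mono-< k _ _ (fst<snd i))

-- Contraction by covectors

module WordPfaffian {c ℓ} (R : CommutativeRing c ℓ) where
  open CommutativeRing R hiding (zero)
  open Pfaffians R
  open RingProperties ring public using (-1*x≈-x)
  open MonoidSum +-monoid using (sum-cong-≋; sum-replicate-zero)
  open CommutativeSemiringExp commutativeSemiring using (^-homo-*; ^-congʳ; ^-distrib-*)
  open SemiringSolver commutativeSemiring using (solve; _:+_; _:*_; _:=_; con)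
  open ListSum +-monoid
  open import Relation.Binary.Reasoning.Setoid setoid

  private
    variable
      i j : Level
      I : Set i
      J : Set j

  -- Negation is written as multiplication by ν, so that the semiring part of
  -- the ring solver suffices.
  ν : Carrier
  ν = - 1#

  x+νx≈0 : ∀ x → x + ν * x ≈ 0#
  x+νx≈0 x = trans (+-congˡ (-1*x≈-x x)) (-‿inverseʳ x)

  νν≈1 : ν * ν ≈ 1#
  νν≈1 = trans (-1*x≈-x ν) (RingProperties.-‿involutive ring 1#)

  square-cancel : ∀ {e} → e * e ≈ 1# → ∀ x → e * (e * x) ≈ x
  square-cancel ee≈1 x = trans (sym (*-assoc _ _ x)) (trans (*-congʳ ee≈1) (*-identityˡ x))

  ννx≈x : ∀ x → ν * (ν * x) ≈ x
  ννx≈x = square-cancel νν≈1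

  -- Interior multiplication by the covector φ.
  contract : (I → Carrier) → (List I → Carrier) → List I → Carrier
  contract φ F []       = 0#
  contract φ F (x ∷ xs) = φ x * F xs + ν * contract φ (F ∘ (x ∷_)) xs

  -- Agreement of `F` and `G` is asked only on words one letter shorter, so that an induction
  -- hypothesis on length can be supplied for it.
  contract-cong : ∀ {φ ψ : I → Carrier} {F G : List I → Carrier} xs → (∀ x → φ x ≈ ψ x) →
                  (∀ ys → suc (length ys) ≡ length xs → F ys ≈ G ys) →
                  contract φ F xs ≈ contract ψ G xs
  contract-cong []       φ≈ψ F≈G = refl
  contract-cong (x ∷ xs) φ≈ψ F≈G =
    +-cong (*-cong (φ≈ψ x) (F≈G xs ≡.refl))
           (*-congˡ (contract-cong xs φ≈ψ λ ys p → F≈G (x ∷ ys) (≡.cong suc p)))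

  contract-congʳ : ∀ (φ : I → Carrier) {F G : List I → Carrier} xs → (∀ ys → F ys ≈ G ys) →
                   contract φ F xs ≈ contract φ G xs
  contract-congʳ φ xs F≈G = contract-cong xs (λ _ → refl) (λ ys _ → F≈G ys)

  contract-+ˡ : ∀ (φ ψ : I → Carrier) F xs →
                contract (λ x → φ x + ψ x) F xs ≈ contract φ F xs + contract ψ F xs
  contract-+ˡ φ ψ F []       = sym (+-identityˡ 0#)
  contract-+ˡ φ ψ F (x ∷ xs) =
    trans (+-congˡ (*-congˡ (contract-+ˡ φ ψ (F ∘ (x ∷_)) xs)))
          (solve 6 (λ n a b f g h → (a :+ b) :* f :+ n :* (g :+ h) :=
               (a :* f :+ n :* g) :+ (b :* f :+ n :* h))
               refl ν (φ x) (ψ x) (F xs) _ _)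

  contract-*ˡ : ∀ α (φ : I → Carrier) F xs →
                contract (λ x → α * φ x) F xs ≈ α * contract φ F xs
  contract-*ˡ α φ F []       = sym (zeroʳ α)
  contract-*ˡ α φ F (x ∷ xs) =
    trans (+-congˡ (*-congˡ (contract-*ˡ α φ (F ∘ (x ∷_)) xs)))
          (solve 5 (λ n a b f g → (a :* b) :* f :+ n :* (a :* g) := a :* (b :* f :+ n :* g))
               refl ν α (φ x) (F xs) _)

  contract-+ʳ : ∀ (φ : I → Carrier) F G xs →
                contract φ (λ ys → F ys + G ys) xs ≈ contract φ F xs + contract φ G xs
  contract-+ʳ φ F G []       = sym (+-identityˡ 0#)
  contract-+ʳ φ F G (x ∷ xs) =
    trans (+-congˡ (*-congˡ (contract-+ʳ φ (F ∘ (x ∷_)) (G ∘ (x ∷_)) xs)))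
          (solve 6 (λ n a f g h k → a :* (f :+ g) :+ n :* (h :+ k) :=
               (a :* f :+ n :* h) :+ (a :* g :+ n :* k))
               refl ν (φ x) (F xs) (G xs) _ _)

  contract-*ʳ : ∀ α (φ : I → Carrier) F xs →
                contract φ (λ ys → α * F ys) xs ≈ α * contract φ F xs
  contract-*ʳ α φ F []       = sym (zeroʳ α)
  contract-*ʳ α φ F (x ∷ xs) =
    trans (+-congˡ (*-congˡ (contract-*ʳ α φ (F ∘ (x ∷_)) xs)))
          (solve 5 (λ n a b f g → b :* (a :* f) :+ n :* (a :* g) := a :* (b :* f :+ n :* g))
               refl ν α (φ x) (F xs) _)

  contract-0ʳ : ∀ (φ : I → Carrier) {F} xs → (∀ ys → suc (length ys) ≡ length xs → F ys ≈ 0#) →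
                contract φ F xs ≈ 0#
  contract-0ʳ φ []       F≈0 = refl
  contract-0ʳ φ (x ∷ xs) F≈0 = begin
    φ x * _ + ν * _
      ≈⟨ +-cong (*-congˡ (F≈0 xs ≡.refl))
                (*-congˡ (contract-0ʳ φ xs λ ys p → F≈0 (x ∷ ys) (≡.cong suc p))) ⟩
    φ x * 0# + ν * 0#  ≈⟨ +-cong (zeroʳ _) (zeroʳ _) ⟩
    0# + 0#            ≈⟨ +-identityˡ 0# ⟩
    0#                 ∎

  contract-map : ∀ (f : I → J) (φ : J → Carrier) F xs →
                 contract (φ ∘ f) (F ∘ map f) xs ≡ contract φ F (map f xs)
  contract-map f φ F []       = ≡.refl
  contract-map f φ F (x ∷ xs) =
    ≡.cong (λ z → φ (f x) * F (map f xs) + ν * z) (contract-map f φ (F ∘ (f x ∷_)) xs)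

  -- One of the two covectors takes the letter `x`, or neither does; in the latter case both pass
  -- over `x` and their signs cancel.
  contract²-∷ : ∀ (φ ψ : I → Carrier) F x xs →
    contract φ (contract ψ F) (x ∷ xs) ≈
    (φ x * contract ψ F xs + ν * (ψ x * contract φ F xs)) + contract φ (contract ψ (F ∘ (x ∷_))) xs
  contract²-∷ φ ψ F x xs = begin
    φ x * contract ψ F xs + ν * contract φ (λ ys → ψ x * F ys + ν * contract ψ Fₓ ys) xs
      ≈⟨ +-congˡ (*-congˡ (contract-+ʳ φ _ _ xs)) ⟩
    φ x * contract ψ F xs +
      ν * (contract φ (λ ys → ψ x * F ys) xs + contract φ (λ ys → ν * contract ψ Fₓ ys) xs)
      ≈⟨ +-congˡ (*-congˡ (+-cong (contract-*ʳ _ φ F xs) (contract-*ʳ ν φ _ xs))) ⟩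
    φ x * contract ψ F xs + ν * (ψ x * contract φ F xs + ν * contract φ (contract ψ Fₓ) xs)
      ≈⟨ solve 4 (λ n a b d → a :+ n :* (b :+ n :* d) := (a :+ n :* b) :+ n :* (n :* d))
           refl ν _ _ _ ⟩
    (φ x * contract ψ F xs + ν * (ψ x * contract φ F xs)) + ν * (ν * contract φ (contract ψ Fₓ) xs)
      ≈⟨ +-congˡ (ννx≈x _) ⟩
    (φ x * contract ψ F xs + ν * (ψ x * contract φ F xs)) + contract φ (contract ψ Fₓ) xs ∎
    where
    Fₓ = F ∘ (x ∷_)

  -- Exchanging `φ` and `ψ` in `contract²-∷` swaps the first two terms up to the sign `ν`; the last
  -- term is handled by induction.
  contract²-anticomm : ∀ (φ ψ : I → Carrier) F xs →
    contract φ (contract ψ F) xs ≈ ν * contract ψ (contract φ F) xs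
  contract²-anticomm φ ψ F []       = sym (zeroʳ ν)
  contract²-anticomm φ ψ F (x ∷ xs) = begin
    contract φ (contract ψ F) (x ∷ xs)
      ≈⟨ contract²-∷ φ ψ F x xs ⟩
    (φ x * contract ψ F xs + ν * (ψ x * contract φ F xs)) + _
      ≈⟨ +-cong (+-congʳ (sym (ννx≈x _))) (contract²-anticomm φ ψ _ xs) ⟩
    (ν * (ν * (φ x * contract ψ F xs)) + ν * (ψ x * contract φ F xs)) + ν * _
      ≈⟨ solve 4 (λ n a b d → (n :* (n :* a) :+ n :* b) :+ n :* d := n :* ((b :+ n :* a) :+ d))
           refl ν _ _ _ ⟩
    ν * ((ψ x * contract φ F xs + ν * (φ x * contract ψ F xs)) + _)
      ≈⟨ *-congˡ (contract²-∷ ψ φ F x xs) ⟨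
    ν * contract ψ (contract φ F) (x ∷ xs) ∎

  -- Anticommutation would only show that twice the value is 0, which is too weak where 2 is a zero
  -- divisor; hence a separate induction.
  contract²-self : ∀ (φ : I → Carrier) F xs → contract φ (contract φ F) xs ≈ 0#
  contract²-self φ F []       = refl
  contract²-self φ F (x ∷ xs) = begin
    contract φ (contract φ F) (x ∷ xs)  ≈⟨ contract²-∷ φ φ F x xs ⟩
    (φ x * contract φ F xs + ν * (φ x * contract φ F xs)) + _
                                        ≈⟨ +-cong (x+νx≈0 _) (contract²-self φ _ xs) ⟩
    0# + 0#                             ≈⟨ +-identityˡ 0# ⟩
    0#                                  ∎

  Alternating : {I : Set i} → (List I → Carrier) → Set _
  Alternating F = ∀ xs y z ys → F (xs ++ y ∷ z ∷ ys) ≈ ν * F (xs ++ z ∷ y ∷ ys)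

  -- The terms that remove `y` and `z` trade places with opposite position signs; in every other
  -- term both letters remain and `F` itself alternates.
  contract-alternating : ∀ (φ : I → Carrier) {F} → Alternating F → Alternating (contract φ F)
  contract-alternating φ {F} alt [] y z ys = begin
    φ y * F (z ∷ ys) + ν * (φ z * F (y ∷ ys) + ν * contract φ (λ us → F (y ∷ z ∷ us)) ys)
      ≈⟨ +-cong (sym (ννx≈x _)) (*-congˡ (+-congˡ (*-congˡ
           (trans (contract-congʳ φ ys (alt [] y z)) (contract-*ʳ ν φ _ ys))))) ⟩
    ν * (ν * (φ y * F (z ∷ ys))) +
      ν * (φ z * F (y ∷ ys) + ν * (ν * contract φ (λ us → F (z ∷ y ∷ us)) ys))
      ≈⟨ solve 4 (λ n a b d → n :* (n :* a) :+ n :* (b :+ n :* (n :* d)) :=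
           n :* (b :+ n :* (a :+ n :* d)))
           refl ν _ _ _ ⟩
    ν * (φ z * F (y ∷ ys) + ν * (φ y * F (z ∷ ys) + ν * contract φ (λ us → F (z ∷ y ∷ us)) ys)) ∎
  contract-alternating φ {F} alt (x ∷ xs) y z ys = begin
    φ x * F (xs ++ y ∷ z ∷ ys) + ν * contract φ (F ∘ (x ∷_)) (xs ++ y ∷ z ∷ ys)
      ≈⟨ +-cong (*-congˡ (alt xs y z ys))
           (*-congˡ (contract-alternating φ (λ us → alt (x ∷ us)) xs y z ys)) ⟩
    φ x * (ν * F (xs ++ z ∷ y ∷ ys)) + ν * (ν * contract φ (F ∘ (x ∷_)) (xs ++ z ∷ y ∷ ys))
      ≈⟨ solve 4 (λ n a b d → a :* (n :* b) :+ n :* (n :* d) := n :* (a :* b :+ n :* d))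
           refl ν _ _ _ ⟩
    ν * (φ x * F (xs ++ z ∷ y ∷ ys) + ν * contract φ (F ∘ (x ∷_)) (xs ++ z ∷ y ∷ ys)) ∎

  -- Pfaffians of words

  Skew : {I : Set i} → (I → I → Carrier) → Set _
  Skew a = ∀ x y → a x y ≈ ν * a y x

  -- The first argument only makes the recursion structural.
  pf≤ : (I → I → Carrier) → ℕ → List I → Carrier
  pf≤ a n       []       = 1#
  pf≤ a zero    (x ∷ xs) = 0#
  pf≤ a (suc n) (x ∷ xs) = contract (a x) (pf≤ a n) xs

  -- The Pfaffian of the matrix with entries a xᵢ xⱼ, by expansion along its first row.
  pf : (I → I → Carrier) → List I → Carrier
  pf a xs = pf≤ a (length xs) xs

  -- Each unit of the bound pays for two removed letters, so a bound at least the length never runs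
  -- out before the word does.
  pf≤-irrelevant : ∀ (a : I → I → Carrier) {m n} xs → length xs ℕ.≤ m → length xs ℕ.≤ n →
                   pf≤ a m xs ≈ pf≤ a n xs
  pf≤-irrelevant a []       _       _       = refl
  pf≤-irrelevant a (x ∷ xs) (s≤s p) (s≤s q) = contract-cong xs (λ _ → refl) λ ys r →
    pf≤-irrelevant a ys (ℕ.≤-trans (ℕ.<⇒≤ (ℕ.≤-reflexive r)) p)
                        (ℕ.≤-trans (ℕ.<⇒≤ (ℕ.≤-reflexive r)) q)

  pf-∷ : ∀ (a : I → I → Carrier) x xs → pf a (x ∷ xs) ≈ contract (a x) (pf a) xs
  pf-∷ a x xs = contract-cong xs (λ _ → refl) λ ys r →
    pf≤-irrelevant a ys (ℕ.<⇒≤ (ℕ.≤-reflexive r)) ℕ.≤-refl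

  -- The last term is a double contraction, the shape of the correction in `pf-+-∧`; this is what
  -- lets that correction be read as two adjoined letters.
  pf-∷∷ : ∀ (a : I → I → Carrier) x y xs →
          pf a (x ∷ y ∷ xs) ≈ a x y * pf a xs + ν * contract (a x) (contract (a y) (pf a)) xs
  pf-∷∷ a x y xs = trans (pf-∷ a x (y ∷ xs)) (+-congˡ (*-congˡ (contract-congʳ (a x) xs (pf-∷ a y))))

  -- The hypothesis concerns words two letters shorter than `x ∷ xs`: what is left once `x` and its
  -- partner are removed.
  length-induction : ∀ {p} (P : List I → Set p) → P [] →
                 (∀ x xs → (∀ ys → suc (length ys) ≡ length xs → P ys) → P (x ∷ xs)) →
                 ∀ xs → P xs
  length-induction P P[] P∷ xs = go (length xs) xs ℕ.≤-refl
    where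
    go : ∀ n xs → length xs ℕ.≤ n → P xs
    go n       []       _       = P[]
    go (suc n) (x ∷ xs) (s≤s p) =
      P∷ x xs λ ys r → go n ys (ℕ.≤-trans (ℕ.<⇒≤ (ℕ.≤-reflexive r)) p)

  pf-map : ∀ (f : I → J) {a : I → I → Carrier} {b : J → J → Carrier} →
           (∀ x y → a x y ≈ b (f x) (f y)) → ∀ xs → pf a xs ≈ pf b (map f xs)
  pf-map f {a} {b} a≈b = length-induction _ refl λ x xs ih → begin
    pf a (x ∷ xs)                             ≈⟨ pf-∷ a x xs ⟩
    contract (a x) (pf a) xs                  ≈⟨ contract-cong xs (a≈b x) ih ⟩
    contract (b (f x) ∘ f) (pf b ∘ map f) xs  ≡⟨ contract-map f (b (f x)) (pf b) xs ⟩
    contract (b (f x)) (pf b) (map f xs)      ≈⟨ pf-∷ b (f x) (map f xs) ⟨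
    pf b (f x ∷ map f xs)                     ∎

  -- Letters disappear in pairs, so an odd word ends in a single letter, which has no partner.
  pf-odd : ∀ (a : I → I → Carrier) k xs → length xs ≡ suc (k ℕ.* 2) → pf a xs ≈ 0#
  pf-odd a zero    (x ∷ [])     _ = refl
  pf-odd a (suc k) (x ∷ y ∷ xs) p = trans (pf-∷ a x (y ∷ xs))
    (contract-0ʳ (a x) (y ∷ xs) λ ys q →
      pf-odd a k ys (ℕ.suc-injective (≡.trans q (ℕ.suc-injective p))))

  ^-even : ∀ {e} → e * e ≈ 1# → ∀ k → e ^ (k ℕ.* 2) ≈ 1#
  ^-even ee≈1 zero    = refl
  ^-even ee≈1 (suc k) = trans (square-cancel ee≈1 _) (^-even ee≈1 k)

  -- For even length the power of `e` is 1; for odd length the Pfaffian is 0.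
  pf-sign : ∀ {e} → e * e ≈ 1# → ∀ (a : I → I → Carrier) xs {n} → length xs ≡ n →
            e ^ n * pf a xs ≈ pf a xs
  pf-sign {e = e} ee≈1 a xs ≡.refl with even⊎odd (length xs)
  ... | inj₁ (k , p) = trans (*-congʳ (trans (^-congʳ e p) (^-even ee≈1 k))) (*-identityˡ _)
  ... | inj₂ (k , p) = trans (*-congˡ (pf-odd a k xs p)) (trans (zeroʳ _) (sym (pf-odd a k xs p)))

  -- For the first two letters the sign comes from skewness of `a` and from anticommutation of `a y`
  -- and `a z`; for later letters it is inherited through the contraction.
  pf≤-alternating : ∀ {a : I → I → Carrier} → Skew a → ∀ n → Alternating (pf≤ a n)
  pf≤-alternating {a = a} skew zero [] y z ys = sym (zeroʳ ν)
  pf≤-alternating {a = a} skew zero (x ∷ xs) y z ys = sym (zeroʳ ν)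
  pf≤-alternating {a = a} skew (suc n) (x ∷ xs) y z ys =
    contract-alternating (a x) (pf≤-alternating skew n) xs y z ys
  -- Inside the contraction the bound is 0, so nonempty words have the default value 0 and the
  -- second term vanishes on both sides.
  pf≤-alternating {a = a} skew (suc zero) [] y z ys = begin
    a y z * pf≤ a 0 ys + ν * contract (a y) _ ys
      ≈⟨ +-cong (*-congʳ (skew y z))
           (*-congˡ (trans (contract-0ʳ (a y) ys λ _ _ → refl)
                    (sym (trans (*-congˡ (contract-0ʳ (a z) ys λ _ _ → refl)) (zeroʳ ν))))) ⟩
    (ν * a z y) * pf≤ a 0 ys + ν * (ν * contract (a z) _ ys)
      ≈⟨ solve 4 (λ n a b d → (n :* a) :* b :+ n :* (n :* d) := n :* (a :* b :+ n :* d))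
           refl ν _ _ _ ⟩
    ν * (a z y * pf≤ a 0 ys + ν * contract (a z) _ ys) ∎
  pf≤-alternating {a = a} skew (suc (suc n)) [] y z ys = begin
    a y z * pf≤ a (suc n) ys + ν * contract (a y) (contract (a z) (pf≤ a n)) ys
      ≈⟨ +-cong (*-congʳ (skew y z)) (*-congˡ (contract²-anticomm (a y) (a z) _ ys)) ⟩
    (ν * a z y) * pf≤ a (suc n) ys + ν * (ν * contract (a z) (contract (a y) (pf≤ a n)) ys)
      ≈⟨ solve 4 (λ n a b d → (n :* a) :* b :+ n :* (n :* d) := n :* (a :* b :+ n :* d))
           refl ν _ _ _ ⟩
    ν * (a z y * pf≤ a (suc n) ys + ν * contract (a z) (contract (a y) (pf≤ a n)) ys) ∎

  pf-alternating : ∀ {a : I → I → Carrier} → Skew a → Alternating (pf a)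
  pf-alternating {a = a} skew xs y z ys = begin
    pf≤ a (length (xs ++ y ∷ z ∷ ys)) (xs ++ y ∷ z ∷ ys)      ≈⟨ pf≤-alternating skew _ xs y z ys ⟩
    ν * pf≤ a (length (xs ++ y ∷ z ∷ ys)) (xs ++ z ∷ y ∷ ys)
      ≡⟨ ≡.cong (λ n → ν * pf≤ a n (xs ++ z ∷ y ∷ ys))
           (≡.trans (List.length-++ xs) (≡.sym (List.length-++ xs))) ⟩
    ν * pf a (xs ++ z ∷ y ∷ ys) ∎

  alternating-move : ∀ {F : List I → Carrier} → Alternating F → ∀ xs y ys →
                     F (xs ++ y ∷ ys) ≈ ν ^ length xs * F (y ∷ xs ++ ys)
  alternating-move     alt []       y ys = sym (*-identityˡ _)
  alternating-move {F = F} alt (x ∷ xs) y ys = begin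
    F (x ∷ xs ++ y ∷ ys)                       ≈⟨ alternating-move {F = F ∘ (x ∷_)} (λ us → alt (x ∷ us)) xs y ys ⟩
    ν ^ length xs * F (x ∷ y ∷ xs ++ ys)       ≈⟨ *-congˡ (alt [] x y (xs ++ ys)) ⟩
    ν ^ length xs * (ν * F (y ∷ x ∷ xs ++ ys)) ≈⟨ solve 3 (λ n a b → a :* (n :* b) := (n :* a) :* b) refl ν _ _ ⟩
    (ν * ν ^ length xs) * F (y ∷ x ∷ xs ++ ys) ∎

  -- No terms of higher order in `u ∧ v` arise, because contracting `Q` once more by `u` or `v`
  -- gives 0.
  pf-+-∧ : ∀ {a a′ : I → I → Carrier} (u v : I → Carrier) →
           (∀ x y → a′ x y ≈ a x y + (u x * v y + ν * (v x * u y))) →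
           ∀ xs → pf a′ xs ≈ pf a xs + contract u (contract v (pf a)) xs
  pf-+-∧ {a = a} {a′} u v a′≈ = length-induction _ (sym (+-identityʳ 1#)) step
    where
    Q = contract u (contract v (pf a))

    vQ≈0 : ∀ xs → contract v Q xs ≈ 0#
    vQ≈0 xs = trans (contract²-anticomm v u _ xs)
      (trans (*-congˡ (contract-0ʳ u xs λ ys _ → contract²-self v (pf a) ys)) (zeroʳ ν))

    -- Moving `a x` outwards past `v` and then past `u` costs two signs, which cancel.
    Q-∷ : ∀ x xs → Q (x ∷ xs) ≈
          (u x * contract v (pf a) xs + ν * (v x * contract u (pf a) xs)) + contract (a x) Q xs
    Q-∷ x xs = trans (contract²-∷ u v (pf a) x xs) (+-congˡ (begin
      contract u (contract v (pf a ∘ (x ∷_))) xs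
        ≈⟨ contract-congʳ u xs (λ ys → contract-congʳ v ys (pf-∷ a x)) ⟩
      contract u (contract v (contract (a x) (pf a))) xs
        ≈⟨ contract-congʳ u xs (contract²-anticomm v (a x) (pf a)) ⟩
      contract u (λ ys → ν * contract (a x) (contract v (pf a)) ys) xs
        ≈⟨ contract-*ʳ ν u _ xs ⟩
      ν * contract u (contract (a x) (contract v (pf a))) xs
        ≈⟨ *-congˡ (contract²-anticomm u (a x) _ xs) ⟩
      ν * (ν * contract (a x) Q xs)
        ≈⟨ ννx≈x _ ⟩
      contract (a x) Q xs ∎))

    split : ∀ x F xs → contract (a′ x) F xs ≈
            contract (a x) F xs + (u x * contract v F xs + ν * (v x * contract u F xs))
    split x F xs = begin
      contract (a′ x) F xs
        ≈⟨ contract-cong xs (a′≈ x) (λ _ _ → refl) ⟩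
      contract (λ y → a x y + (u x * v y + ν * (v x * u y))) F xs
        ≈⟨ contract-+ˡ (a x) _ F xs ⟩
      contract (a x) F xs + contract (λ y → u x * v y + ν * (v x * u y)) F xs
        ≈⟨ +-congˡ (trans (contract-+ˡ _ _ F xs)
             (+-cong (contract-*ˡ _ v F xs)
               (trans (contract-*ˡ ν _ F xs) (*-congˡ (contract-*ˡ _ u F xs))))) ⟩
      contract (a x) F xs + (u x * contract v F xs + ν * (v x * contract u F xs)) ∎

    step : ∀ x xs → (∀ ys → suc (length ys) ≡ length xs → pf a′ ys ≈ pf a ys + Q ys) →
           pf a′ (x ∷ xs) ≈ pf a (x ∷ xs) + Q (x ∷ xs)
    step x xs ih = begin
      pf a′ (x ∷ xs)
        ≈⟨ pf-∷ a′ x xs ⟩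
      contract (a′ x) (pf a′) xs
        ≈⟨ contract-cong xs (λ _ → refl) ih ⟩
      contract (a′ x) (λ ys → pf a ys + Q ys) xs
        ≈⟨ contract-+ʳ (a′ x) (pf a) Q xs ⟩
      contract (a′ x) (pf a) xs + contract (a′ x) Q xs
        ≈⟨ +-cong (split x (pf a) xs) (split x Q xs) ⟩
      (contract (a x) (pf a) xs + (u x * contract v (pf a) xs + ν * (v x * contract u (pf a) xs)))
        + (contract (a x) Q xs + (u x * contract v Q xs + ν * (v x * contract u Q xs)))
        ≈⟨ +-congˡ (+-congˡ (+-cong (*-congˡ (vQ≈0 xs)) (*-congˡ (*-congˡ (contract²-self u _ xs))))) ⟩
      (contract (a x) (pf a) xs + (u x * contract v (pf a) xs + ν * (v x * contract u (pf a) xs)))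
        + (contract (a x) Q xs + (u x * 0# + ν * (v x * 0#)))
        ≈⟨ solve 6 (λ p q r s n t → (p :+ q) :+ (r :+ (s :* con 0 :+ n :* (t :* con 0))) := p :+ (q :+ r))
             refl (contract (a x) (pf a) xs) _ (contract (a x) Q xs) (u x) ν (v x) ⟩
      contract (a x) (pf a) xs +
        ((u x * contract v (pf a) xs + ν * (v x * contract u (pf a) xs)) + contract (a x) Q xs)
        ≈⟨ +-cong (pf-∷ a x xs) (Q-∷ x xs) ⟨
      pf a (x ∷ xs) + Q (x ∷ xs) ∎

  sumOver-*ˡ : ∀ α (xs : List I) f → sumOver xs (λ x → α * f x) ≈ α * sumOver xs f
  sumOver-*ˡ α []       f = sym (zeroʳ α)
  sumOver-*ˡ α (x ∷ xs) f = trans (+-congˡ (sumOver-*ˡ α xs f)) (sym (distribˡ α _ _))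

  ^-square : ∀ {e} → e * e ≈ 1# → ∀ n → e ^ n * e ^ n ≈ 1#
  ^-square {e} ee≈1 n = trans (sym (^-homo-* e n n)) (trans (^-congʳ e n+n≡n*2) (^-even ee≈1 n))
    where
    n+n≡n*2 : n ℕ.+ n ≡ n ℕ.* 2
    n+n≡n*2 = ≡.trans (≡.cong (n ℕ.+_) (≡.sym (ℕ.+-identityʳ n))) (ℕ.*-comm 2 n)

  -- By `pf-sign` a factor `e ^ (m + n)` can be inserted, and its part `e ^ m` cancels the one in
  -- front.
  pf-exchange-sign : ∀ {e} → e * e ≈ 1# → ∀ (a : I → I → Carrier) xs m n → length xs ≡ m ℕ.+ n →
                     e ^ m * pf a xs ≈ e ^ n * pf a xs
  pf-exchange-sign {e = e} ee≈1 a xs m n p = begin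
    e ^ m * pf a xs                    ≈⟨ *-congˡ (pf-sign ee≈1 a xs p) ⟨
    e ^ m * (e ^ (m ℕ.+ n) * pf a xs)  ≈⟨ *-congˡ (*-congʳ (^-homo-* e m n)) ⟩
    e ^ m * ((e ^ m * e ^ n) * pf a xs)
      ≈⟨ *-congˡ (*-assoc _ _ _) ⟩
    e ^ m * (e ^ m * (e ^ n * pf a xs))
      ≈⟨ square-cancel (^-square ee≈1 m) _ ⟩
    e ^ n * pf a xs                    ∎

  -- A word of length 2r contributes `e` once per pair, and r has the parity of C(2r,2) = r(2r-1).
  -- In odd length both sides are 0.
  pf-scale : ∀ {e} → e * e ≈ 1# → ∀ (b : J → J → Carrier) xs →
             pf (λ x y → e * b x y) xs ≈ e ^ (length xs C 2) * pf b xs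
  pf-scale {e = e} ee≈1 b = length-induction _ (sym (*-identityˡ 1#)) step
    where
    -- C(n+2,2) = C(n,2) + 2n + 1, and the even part 2n does not affect the sign.
    e² : ∀ n → e ^ (suc (suc n) C 2) ≈ e * e ^ (n C 2)
    e² n = begin
      e ^ (suc (suc n) C 2)
        ≡⟨ ≡.cong (e ^_) (≡.trans ([1+n]C2≡nC2+n (suc n)) (≡.cong (ℕ._+ suc n) ([1+n]C2≡nC2+n n))) ⟩
      e ^ (n C 2 ℕ.+ n ℕ.+ suc n)
        ≈⟨ trans (^-homo-* e (n C 2 ℕ.+ n) (suc n)) (*-congʳ (^-homo-* e (n C 2) n)) ⟩
      (e ^ (n C 2) * e ^ n) * (e * e ^ n)
        ≈⟨ solve 3 (λ p q r → (p :* q) :* (r :* q) := (r :* p) :* (q :* q)) refl _ _ _ ⟩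
      (e * e ^ (n C 2)) * (e ^ n * e ^ n)
        ≈⟨ trans (*-congˡ (^-square ee≈1 n)) (*-identityʳ _) ⟩
      e * e ^ (n C 2) ∎

    step : ∀ x xs → (∀ ys → suc (length ys) ≡ length xs →
                     pf (λ x y → e * b x y) ys ≈ e ^ (length ys C 2) * pf b ys) →
           pf (λ x y → e * b x y) (x ∷ xs) ≈ e ^ (suc (length xs) C 2) * pf b (x ∷ xs)
    step x []       ih = sym (zeroʳ _)
    step x (y ∷ ys) ih = begin
      pf (λ x y → e * b x y) (x ∷ y ∷ ys)
        ≈⟨ pf-∷ _ x (y ∷ ys) ⟩
      contract (λ z → e * b x z) (pf (λ x y → e * b x y)) (y ∷ ys)
        ≈⟨ contract-cong (y ∷ ys) (λ _ → refl) (λ us p → trans (ih us p)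
             (*-congʳ (^-congʳ e (≡.cong (_C 2) (ℕ.suc-injective p))))) ⟩
      contract (λ z → e * b x z) (λ us → e ^ (length ys C 2) * pf b us) (y ∷ ys)
        ≈⟨ trans (contract-*ˡ e (b x) (λ us → e ^ (length ys C 2) * pf b us) (y ∷ ys))
           (*-congˡ (contract-*ʳ _ (b x) (pf b) (y ∷ ys))) ⟩
      e * (e ^ (length ys C 2) * contract (b x) (pf b) (y ∷ ys))
        ≈⟨ *-assoc _ _ _ ⟨
      (e * e ^ (length ys C 2)) * contract (b x) (pf b) (y ∷ ys)
        ≈⟨ *-cong (e² (length ys)) (pf-∷ b x (y ∷ ys)) ⟨
      e ^ (suc (suc (length ys)) C 2) * pf b (x ∷ y ∷ ys) ∎

  -- The identity for words

  infixr 5 _⊎++_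
  _⊎++_ : List I → List J → List (I ⊎ J)
  xs ⊎++ ys = map inj₁ xs ++ map inj₂ ys

  -- Since `φ` vanishes on the right alphabet, only letters of `xs` are removed, and `ys` stays
  -- intact as the constant factor `h`.
  contract-⊎++ : ∀ (φ : I ⊎ J → Carrier) F (G : List I → Carrier) h xs ys →
                 (∀ y → φ (inj₂ y) ≈ 0#) →
                 (∀ us → suc (length us) ≡ length xs → F (us ⊎++ ys) ≈ G us * h) →
                 contract φ F (xs ⊎++ ys) ≈ contract (φ ∘ inj₁) G xs * h
  contract-⊎++ φ F G h [] ys φ≈0 F≈G*h = trans (vanish F ys) (sym (zeroˡ h))
    where
    vanish : ∀ F ys → contract φ F (map inj₂ ys) ≈ 0#
    vanish F []       = refl
    vanish F (y ∷ ys) = trans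
      (+-cong (trans (*-congʳ (φ≈0 y)) (zeroˡ _)) (trans (*-congˡ (vanish (F ∘ (inj₂ y ∷_)) ys)) (zeroʳ ν)))
      (+-identityˡ 0#)
  contract-⊎++ φ F G h (x ∷ xs) ys φ≈0 F≈G*h = begin
    φ (inj₁ x) * F (xs ⊎++ ys) + ν * contract φ (F ∘ (inj₁ x ∷_)) (xs ⊎++ ys)
      ≈⟨ +-cong (*-congˡ (F≈G*h xs ≡.refl))
           (*-congˡ (contract-⊎++ φ _ (G ∘ (x ∷_)) h xs ys φ≈0
             λ us p → F≈G*h (x ∷ us) (≡.cong suc p))) ⟩
    φ (inj₁ x) * (G xs * h) + ν * (contract (φ ∘ inj₁) (G ∘ (x ∷_)) xs * h)
      ≈⟨ solve 5 (λ p g h n q → p :* (g :* h) :+ n :* (q :* h) := (p :* g :+ n :* q) :* h)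
           refl _ _ _ _ _ ⟩
    (φ (inj₁ x) * G xs + ν * contract (φ ∘ inj₁) (G ∘ (x ∷_)) xs) * h ∎

  module _ {I : Set i} {J : Set j} {a : I → I → Carrier} {b : J → J → Carrier}
           (a-skew : Skew a) (b-skew : Skew b) {e} (ee≈1 : e * e ≈ 1#)
    where

    -- The entries of S ᵗT: `a x (c k)` stands for the entry of S in row `x` and column `k`, and
    -- `b y (d k)` for that of T.
    cross : ∀ {l} → Vector I l → Vector J l → I → J → Carrier
    cross c d x y = sum (λ k → a x (c k) * b y (d k))

    -- The form behind the right-hand block matrix, defined on column letters as well, so that these
    -- can be adjoined to the words.
    glue : ∀ {l} → Vector I l → Vector J l → I ⊎ J → I ⊎ J → Carrier
    glue c d (inj₁ x) (inj₁ x′) = a x x′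
    glue c d (inj₁ x) (inj₂ y)  = cross c d x y
    glue c d (inj₂ y) (inj₁ x)  = ν * cross c d x y
    glue c d (inj₂ y) (inj₂ y′) = e * b y y′

    glue-skew : ∀ {l} (c : Vector I l) d → Skew (glue c d)
    glue-skew c d (inj₁ x) (inj₁ x′) = a-skew x x′
    glue-skew c d (inj₁ x) (inj₂ y)  = sym (ννx≈x _)
    glue-skew c d (inj₂ y) (inj₁ x)  = refl
    glue-skew c d (inj₂ y) (inj₂ y′) = trans (*-congˡ (b-skew y y′))
      (solve 3 (λ p q r → p :* (q :* r) := q :* (p :* r)) refl _ _ _)

    -- Without columns `cross` is the empty sum, the form is block diagonal, and the Pfaffian
    -- factors; `pf-scale` extracts `e` from the second block.
    pf-glue-[] : ∀ (c : Vector I 0) d w w′ →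
                 pf (glue c d) (w ⊎++ w′) ≈ pf a w * (e ^ (length w′ C 2) * pf b w′)
    pf-glue-[] c d w w′ = length-induction
      (λ w → pf (glue c d) (w ⊎++ w′) ≈ pf a w * (e ^ (length w′ C 2) * pf b w′)) base step w
      where
      base : pf (glue c d) (map inj₂ w′) ≈ 1# * (e ^ (length w′ C 2) * pf b w′)
      base = begin
        pf (glue c d) (map inj₂ w′)             ≈⟨ pf-map inj₂ (λ _ _ → refl) w′ ⟨
        pf (λ x y → e * b x y) w′               ≈⟨ pf-scale ee≈1 b w′ ⟩
        e ^ (length w′ C 2) * pf b w′           ≈⟨ *-identityˡ _ ⟨
        1# * (e ^ (length w′ C 2) * pf b w′)    ∎

      step : ∀ x w → _ → _
      step x w ih = trans (pf-∷ (glue c d) (inj₁ x) (w ⊎++ w′))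
        (trans (contract-⊎++ _ _ (pf a) _ w w′ (λ _ → refl) ih) (*-congʳ (sym (pf-∷ a x w))))

    -- The isotropy hypotheses on the column letters express the zero block `O`. They make `cross`
    -- for the remaining columns vanish when its first argument is `c₀` or its second is `d₀`.
    module Step {l} (c : Vector I (suc l)) (d : Vector J (suc l))
                (c-iso : ∀ k k′ → a (c k) (c k′) ≈ 0#) (d-iso : ∀ k k′ → b (d k) (d k′) ≈ 0#)
      where
      c₀ = c zero
      d₀ = d zero
      G  = glue (c ∘ suc) (d ∘ suc)

      -- Chosen so that `u x * v y` is the first column's summand of `cross c d`.
      u v : I ⊎ J → Carrier
      u (inj₁ x) = a x c₀
      u (inj₂ y) = 0#
      v (inj₁ x) = 0#
      v (inj₂ y) = b y d₀

      sum-zero : ∀ {n} (t : Vector Carrier n) → (∀ k → t k ≈ 0#) → sum t ≈ 0#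
      sum-zero {n} t t≈0 = trans (sum-cong-≋ t≈0) (sum-replicate-zero n)

      cross-c₀ : ∀ y → cross (c ∘ suc) (d ∘ suc) c₀ y ≈ 0#
      cross-c₀ y = sum-zero _ λ k → trans (*-congʳ (c-iso zero (suc k))) (zeroˡ _)

      cross-d₀ : ∀ x → cross (c ∘ suc) (d ∘ suc) x d₀ ≈ 0#
      cross-d₀ x = sum-zero _ λ k → trans (*-congˡ (d-iso zero (suc k))) (zeroʳ _)

      glue≈G+u∧v : ∀ x y → glue c d x y ≈ G x y + (u x * v y + ν * (v x * u y))
      glue≈G+u∧v (inj₁ x) (inj₁ x′) =
        solve 4 (λ f g h n → f := f :+ (g :* con 0 :+ n :* (con 0 :* h))) refl _ _ _ ν
      glue≈G+u∧v (inj₁ x) (inj₂ y)  =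
        solve 4 (λ f g h n → f :* g :+ h := h :+ (f :* g :+ n :* (con 0 :* con 0))) refl _ _ _ ν
      glue≈G+u∧v (inj₂ y) (inj₁ x)  =
        solve 4 (λ f g h n → n :* (f :* g :+ h) := n :* h :+ (con 0 :* con 0 :+ n :* (g :* f)))
          refl _ _ _ ν
      glue≈G+u∧v (inj₂ y) (inj₂ y′) =
        solve 4 (λ f g h n → f := f :+ (con 0 :* g :+ n :* (h :* con 0))) refl _ _ _ ν

      u≈νG : ∀ x → u x ≈ ν * G (inj₁ c₀) x
      u≈νG (inj₁ x) = a-skew x c₀
      u≈νG (inj₂ y) = sym (trans (*-congˡ (cross-c₀ y)) (zeroʳ ν))

      -- `ν` comes from reversing the arguments of `b`. `G` already carries a factor `e` on the
      -- second alphabet, and a second `e` cancels it.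
      v≈νeG : ∀ x → v x ≈ (ν * e) * G (inj₂ d₀) x
      v≈νeG (inj₁ x) = sym (trans (*-congˡ (trans (*-congˡ (cross-d₀ x)) (zeroʳ ν))) (zeroʳ _))
      v≈νeG (inj₂ y) = trans (b-skew y d₀) (trans (*-congˡ (sym (square-cancel ee≈1 _)))
        (sym (*-assoc _ _ _)))

      pf-glue-∷ : ∀ w → pf (glue c d) w ≈ pf G w + (ν * e) * pf G (inj₁ c₀ ∷ inj₂ d₀ ∷ w)
      pf-glue-∷ w = trans (pf-+-∧ u v glue≈G+u∧v w) (+-congˡ (begin
        contract u (contract v (pf G)) w
          ≈⟨ contract-cong w u≈νG (λ ys _ → trans (contract-cong ys v≈νeG (λ _ _ → refl))
               (contract-*ˡ (ν * e) (G (inj₂ d₀)) (pf G) ys)) ⟩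
        contract (λ x → ν * G (inj₁ c₀) x) (λ ys → (ν * e) * contract (G (inj₂ d₀)) (pf G) ys) w
          ≈⟨ trans (contract-*ˡ ν _ _ w) (*-congˡ (contract-*ʳ (ν * e) _ _ w)) ⟩
        ν * ((ν * e) * contract (G (inj₁ c₀)) (contract (G (inj₂ d₀)) (pf G)) w)
          -- The zero summand inserted here is the pairing of `c₀` with `d₀`, completing the
          -- expansion in `pf-∷∷`.
          ≈⟨ solve 4 (λ n g z p → n :* (g :* p) := g :* (con 0 :* z :+ n :* p)) refl ν (ν * e) _ _ ⟩
        (ν * e) * (0# * pf G w + ν * contract (G (inj₁ c₀)) (contract (G (inj₂ d₀)) (pf G)) w)
          ≈⟨ *-congˡ (trans (pf-∷∷ G (inj₁ c₀) (inj₂ d₀) w) (+-congʳ (*-congʳ (cross-c₀ d₀)))) ⟨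
        (ν * e) * pf G (inj₁ c₀ ∷ inj₂ d₀ ∷ w) ∎))

      -- `c₀` passes the letters of `w`, then `d₀` passes those of `w` and `w′`; the two passages
      -- over `w` cancel in sign.
      pf-move : ∀ w w′ → pf G ((w ++ c₀ ∷ []) ⊎++ (w′ ++ d₀ ∷ [])) ≈
                ν ^ length w′ * pf G (inj₁ c₀ ∷ inj₂ d₀ ∷ w ⊎++ w′)
      pf-move w w′ = begin
        pf G ((w ++ c₀ ∷ []) ⊎++ (w′ ++ d₀ ∷ []))
          ≡⟨ ≡.cong (pf G) (≡.trans
               (≡.cong₂ _++_ (List.map-++ inj₁ w (c₀ ∷ [])) (List.map-++ inj₂ w′ (d₀ ∷ [])))
               (List.++-assoc (map inj₁ w) _ _)) ⟩
        pf G (map inj₁ w ++ inj₁ c₀ ∷ map inj₂ w′ ++ inj₂ d₀ ∷ [])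
          ≈⟨ alternating-move {F = pf G} G-alt (map inj₁ w) _ _ ⟩
        ν ^ length (map inj₁ w) * pf G (inj₁ c₀ ∷ map inj₁ w ++ map inj₂ w′ ++ inj₂ d₀ ∷ [])
          ≡⟨ ≡.cong₂ (λ n us → ν ^ n * pf G (inj₁ c₀ ∷ us)) (List.length-map inj₁ w)
               (≡.sym (List.++-assoc (map inj₁ w) _ _)) ⟩
        ν ^ length w * pf G (inj₁ c₀ ∷ (w ⊎++ w′) ++ inj₂ d₀ ∷ [])
          ≈⟨ *-congˡ (alternating-move {F = pf G ∘ (inj₁ c₀ ∷_)} (λ us → G-alt (inj₁ c₀ ∷ us))
               (w ⊎++ w′) (inj₂ d₀) []) ⟩
        ν ^ length w * (ν ^ length (w ⊎++ w′) * pf G (inj₁ c₀ ∷ inj₂ d₀ ∷ (w ⊎++ w′) ++ []))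
          ≡⟨ ≡.cong₂ (λ n us → ν ^ length w * (ν ^ n * pf G (inj₁ c₀ ∷ inj₂ d₀ ∷ us)))
               (≡.trans (List.length-++ (map inj₁ w))
                 (≡.cong₂ ℕ._+_ (List.length-map inj₁ w) (List.length-map inj₂ w′)))
               (List.++-identityʳ (w ⊎++ w′)) ⟩
        ν ^ length w * (ν ^ (length w ℕ.+ length w′) * pf G (inj₁ c₀ ∷ inj₂ d₀ ∷ w ⊎++ w′))
          ≈⟨ *-congˡ (trans (*-congʳ (^-homo-* ν (length w) (length w′))) (*-assoc _ _ _)) ⟩
        ν ^ length w * (ν ^ length w * (ν ^ length w′ * pf G (inj₁ c₀ ∷ inj₂ d₀ ∷ w ⊎++ w′)))
          ≈⟨ square-cancel (^-square νν≈1 (length w)) _ ⟩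
        ν ^ length w′ * pf G (inj₁ c₀ ∷ inj₂ d₀ ∷ w ⊎++ w′) ∎
        where G-alt = pf-alternating (glue-skew (c ∘ suc) (d ∘ suc))

    -- The words hold the rows and the columns already selected; `K` selects among the columns still
    -- undecided.
    summand : ∀ {l} → Vector I l → Vector J l → List I → List J → Subset l → Carrier
    summand c d w w′ K = (ν * e) ^ (∣ K ∣ C 2)
      * pf a (w ++ tabulate (c ∘ element K)) * pf b (w′ ++ tabulate (d ∘ element K))

    [νe]²≈1 : (ν * e) * (ν * e) ≈ 1#
    [νe]²≈1 = trans (solve 2 (λ n e → (n :* e) :* (n :* e) := (n :* n) :* (e :* e)) refl ν e)
      (trans (*-cong νν≈1 ee≈1) (*-identityˡ 1#))

    -- Passing from `K` to `inside ∷ K` multiplies the sign by `g ^ k`. As the second word has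
    -- length `k + suc (length w′)`, `pf-exchange-sign` replaces this by a sign independent of `K`,
    -- which can leave the sum.
    summand-inside : ∀ {l} (c : Vector I (suc l)) d w w′ K →
      summand c d w w′ (inside ∷ᵥ K) ≈
      (ν * e) ^ suc (length w′) *
        summand (c ∘ suc) (d ∘ suc) (w ++ c zero ∷ []) (w′ ++ d zero ∷ []) K
    summand-inside c d w w′ K = begin
      g ^ (suc k C 2) * pf a (w ++ c zero ∷ cK) * pf b (w′ ++ d zero ∷ dK)
        ≡⟨ ≡.cong₂ (λ us vs → g ^ (suc k C 2) * pf a us * pf b vs)
             (≡.sym (List.++-assoc w (c zero ∷ []) cK)) (≡.sym (List.++-assoc w′ (d zero ∷ []) dK)) ⟩
      g ^ (suc k C 2) * A * B
        ≈⟨ *-congʳ (*-congʳ (trans (^-congʳ g ([1+n]C2≡nC2+n k)) (^-homo-* g (k C 2) k))) ⟩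
      (g ^ (k C 2) * g ^ k) * A * B
        ≈⟨ solve 4 (λ p q a b → (p :* q) :* a :* b := p :* a :* (q :* b)) refl _ _ A B ⟩
      g ^ (k C 2) * A * (g ^ k * B)
        ≈⟨ *-congˡ (pf-exchange-sign [νe]²≈1 b ((w′ ++ d zero ∷ []) ++ dK) k (suc (length w′)) lengthB) ⟩
      g ^ (k C 2) * A * (g ^ suc (length w′) * B)
        ≈⟨ solve 3 (λ p q b → p :* (q :* b) := q :* (p :* b)) refl _ (g ^ suc (length w′)) B ⟩
      g ^ suc (length w′) * (g ^ (k C 2) * A * B) ∎
      where
      g  = ν * e
      k  = ∣ K ∣
      cK = tabulate (c ∘ suc ∘ element K)
      dK = tabulate (d ∘ suc ∘ element K)
      A  = pf a ((w ++ c zero ∷ []) ++ cK)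
      B  = pf b ((w′ ++ d zero ∷ []) ++ dK)

      lengthB : length ((w′ ++ d zero ∷ []) ++ dK) ≡ k ℕ.+ suc (length w′)
      lengthB = ≡.trans (List.length-++ (w′ ++ d zero ∷ []))
        (≡.trans (≡.cong₂ ℕ._+_
          (≡.trans (List.length-++ w′) (ℕ.+-comm (length w′) 1)) (List.length-tabulate _))
          (ℕ.+-comm (suc (length w′)) k))

    sum-pf*pf≈pf-glue : ∀ {l} (c : Vector I l) (d : Vector J l) →
      (∀ k k′ → a (c k) (c k′) ≈ 0#) → (∀ k k′ → b (d k) (d k′) ≈ 0#) → ∀ w w′ →
      sumOver (subsets l) (summand c d w w′) ≈ e ^ (length w′ C 2) * pf (glue c d) (w ⊎++ w′)
    sum-pf*pf≈pf-glue {zero} c d c-iso d-iso w w′ = begin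
      1# * pf a (w ++ []) * pf b (w′ ++ []) + 0#
        ≡⟨ ≡.cong₂ (λ us vs → 1# * pf a us * pf b vs + 0#) (List.++-identityʳ w) (List.++-identityʳ w′) ⟩
      1# * pf a w * pf b w′ + 0#
        ≈⟨ trans (+-identityʳ _) (*-congʳ (*-identityˡ _)) ⟩
      pf a w * pf b w′
        -- The sign is inserted twice: one copy goes to the front, the other is the one in
        -- `pf-glue-[]`.
        ≈⟨ *-congˡ (square-cancel (^-square ee≈1 (length w′ C 2)) _) ⟨
      pf a w * (s * (s * pf b w′))
        ≈⟨ solve 3 (λ p s q → p :* (s :* q) := s :* (p :* q)) refl _ s _ ⟩
      s * (pf a w * (s * pf b w′))
        ≈⟨ *-congˡ (pf-glue-[] c d w w′) ⟨
      s * pf (glue c d) (w ⊎++ w′) ∎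
      where s = e ^ (length w′ C 2)
    sum-pf*pf≈pf-glue {suc l} c d c-iso d-iso w w′ = begin
      sumOver (subsets (suc l)) (summand c d w w′)
        ≈⟨ ∑-++ (map (outside ∷ᵥ_) (subsets l)) _ _ ⟩
      sumOver (map (outside ∷ᵥ_) (subsets l)) (summand c d w w′)
        + sumOver (map (inside ∷ᵥ_) (subsets l)) (summand c d w w′)
        ≡⟨ ≡.cong₂ _+_ (∑-map _ (subsets l) _) (∑-map _ (subsets l) _) ⟩
      sumOver (subsets l) (summand (c ∘ suc) (d ∘ suc) w w′)
        + sumOver (subsets l) (λ K → summand c d w w′ (inside ∷ᵥ K))
        ≈⟨ +-cong (sum-pf*pf≈pf-glue (c ∘ suc) (d ∘ suc) c-iso′ d-iso′ w w′)
             (trans (∑-cong (subsets l) (summand-inside c d w w′)) (sumOver-*ˡ _ (subsets l) _)) ⟩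
      e ^ (n C 2) * pf G W + g ^ suc n *
        sumOver (subsets l) (summand (c ∘ suc) (d ∘ suc) (w ++ c₀ ∷ []) (w′ ++ d₀ ∷ []))
        ≈⟨ +-congˡ (*-congˡ (sum-pf*pf≈pf-glue (c ∘ suc) (d ∘ suc) c-iso′ d-iso′
             (w ++ c₀ ∷ []) (w′ ++ d₀ ∷ []))) ⟩
      e ^ (n C 2) * pf G W + g ^ suc n *
        (e ^ (length (w′ ++ d₀ ∷ []) C 2) * pf G ((w ++ c₀ ∷ []) ⊎++ (w′ ++ d₀ ∷ [])))
        ≈⟨ +-congˡ (*-congˡ (*-cong sign (pf-move w w′))) ⟩
      e ^ (n C 2) * pf G W + g ^ suc n *
        ((e ^ (n C 2) * e ^ n) * (ν ^ n * pf G (inj₁ c₀ ∷ inj₂ d₀ ∷ W)))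
        ≈⟨ +-congˡ (*-congʳ (*-congˡ (^-distrib-* ν e n))) ⟩
      e ^ (n C 2) * pf G W + (g * (ν ^ n * e ^ n)) *
        ((e ^ (n C 2) * e ^ n) * (ν ^ n * pf G (inj₁ c₀ ∷ inj₂ d₀ ∷ W)))
        -- `ν ^ n` and `e ^ n` each occur twice and cancel. What is left of the power of `g` is one
        -- factor, the coefficient in `pf-glue-∷`.
        ≈⟨ solve 6 (λ s p g x y q →
             s :* p :+ (g :* (x :* y)) :* ((s :* y) :* (x :* q)) :=
             s :* (p :+ g :* ((x :* x) :* ((y :* y) :* q)))) refl _ _ g (ν ^ n) (e ^ n) _ ⟩
      e ^ (n C 2) * (pf G W + g * ((ν ^ n * ν ^ n) * ((e ^ n * e ^ n) * pf G (inj₁ c₀ ∷ inj₂ d₀ ∷ W))))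
        ≈⟨ *-congˡ (+-congˡ (*-congˡ (trans (trans (*-congʳ (^-square νν≈1 n)) (*-identityˡ _))
             (trans (*-congʳ (^-square ee≈1 n)) (*-identityˡ _))))) ⟩
      e ^ (n C 2) * (pf G W + g * pf G (inj₁ c₀ ∷ inj₂ d₀ ∷ W))
        ≈⟨ *-congˡ (pf-glue-∷ W) ⟨
      e ^ (n C 2) * pf (glue c d) W ∎
      where
      open Step c d c-iso d-iso
      g = ν * e
      n = length w′
      W = w ⊎++ w′
      c-iso′ = λ k k′ → c-iso (suc k) (suc k′)
      d-iso′ = λ k k′ → d-iso (suc k) (suc k′)

      sign : e ^ (length (w′ ++ d₀ ∷ []) C 2) ≈ e ^ (n C 2) * e ^ n
      sign = trans (^-congʳ e (≡.trans
        (≡.cong (_C 2) (≡.trans (List.length-++ w′) (ℕ.+-comm n 1))) ([1+n]C2≡nC2+n n)))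
        (^-homo-* e (n C 2) n)

  -- From the sum over F₂ᵣ to words

  sum-*ˡ : ∀ {n} α (t : Vector Carrier n) → sum (λ k → α * t k) ≈ α * sum t
  sum-*ˡ {zero}  α t = sym (zeroʳ α)
  sum-*ˡ {suc n} α t = trans (+-congˡ (sum-*ˡ α (t ∘ suc))) (sym (distribˡ α _ _))

  -- Each skipped letter costs one factor `ν`, and `punchIn k` lists the letters that remain.
  contract-tabulate : ∀ {n} (φ : I → Carrier) F (f : Fin (suc n) → I) →
    contract φ F (tabulate f) ≈
    sum (λ k → ν ^ toℕ k * (φ (f k) * F (tabulate (f ∘ punchIn k))))
  contract-tabulate {n = zero}  φ F f = +-cong (sym (*-identityˡ _)) (zeroʳ ν)
  contract-tabulate {n = suc n} φ F f = +-cong (sym (*-identityˡ _)) (begin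
    ν * contract φ (F ∘ (f zero ∷_)) (tabulate (f ∘ suc))
      ≈⟨ *-congˡ (contract-tabulate φ (F ∘ (f zero ∷_)) (f ∘ suc)) ⟩
    ν * sum (λ k → ν ^ toℕ k * t k)    ≈⟨ sum-*ˡ ν (λ k → ν ^ toℕ k * t k) ⟨
    sum (λ k → ν * (ν ^ toℕ k * t k))  ≈⟨ sum-cong-≋ (λ k → sym (*-assoc ν (ν ^ toℕ k) (t k))) ⟩
    sum (λ k → ν ^ suc (toℕ k) * t k)  ∎)
    where
    t = λ k → φ (f (suc k)) * F (f zero ∷ tabulate (f ∘ suc ∘ punchIn k))

  when-*ˡ : ∀ {p} {P : Set p} (P? : Dec P) α x → when P? (α * x) ≈ α * when P? x
  when-*ˡ P? α x with does P?
  ... | true  = refl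
  ... | false = sym (zeroʳ α)

  module _ {r} (X : Matrix (suc r ℕ.* 2) (suc r ℕ.* 2)) where

    minor : Fin (suc (r ℕ.* 2)) → Matrix (r ℕ.* 2) (r ℕ.* 2)
    minor k i j = X (suc (punchIn k i)) (suc (punchIn k j))

    term : Permutation′ (suc r ℕ.* 2) → Carrier
    term σ = sgn σ * product (λ (i : Fin (suc r)) → X (σ ⟨$⟩ʳ fstPos i) (σ ⟨$⟩ʳ sndPos i))

    minor-term : ∀ k → Permutation′ (r ℕ.* 2) → Carrier
    minor-term k π = sgn π * product (λ (i : Fin r) → minor k (π ⟨$⟩ʳ fstPos i) (π ⟨$⟩ʳ sndPos i))

    term-insert : ∀ k π → term (Perm.insert zero zero (Perm.insert zero k π)) ≈
                  (ν ^ toℕ k * X zero (suc k)) * minor-term k π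
    term-insert k π = begin
      ν ^ inversions (Perm.insert zero zero τ) * (X zero (suc k) * Π)
        ≡⟨ ≡.cong (λ n → ν ^ n * (X zero (suc k) * Π))
             (≡.trans (inversions-insert zero τ) (inversions-insert k π)) ⟩
      ν ^ (toℕ k ℕ.+ inversions π) * (X zero (suc k) * Π)
        ≈⟨ *-congʳ (^-homo-* ν (toℕ k) (inversions π)) ⟩
      (ν ^ toℕ k * sgn π) * (X zero (suc k) * Π)
        ≈⟨ solve 4 (λ p q x y → (p :* q) :* (x :* y) := (p :* x) :* (q :* y)) refl _ _ _ _ ⟩
      (ν ^ toℕ k * X zero (suc k)) * (sgn π * Π) ∎
      where
      τ = Perm.insert zero k π
      Π = product (λ (i : Fin r) → minor k (π ⟨$⟩ʳ fstPos i) (π ⟨$⟩ʳ sndPos i))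

    -- Membership in F forces σ(0) = 0, so only the outer insertion at `zero` survives; the inner
    -- insertion chooses σ(1) = `suc k`. By `inversions-insert` these add 0 and `toℕ k` inversions.
    pfaffian-suc : pfaffian (suc r) X ≈
                   sum (λ k → ν ^ toℕ k * (X zero (suc k) * pfaffian r (minor k)))
    pfaffian-suc = begin
      pfaffian (suc r) X
        ≈⟨ ∑-filter (inF? (suc r)) (permutations (suc r ℕ.* 2)) term ⟩
      ∑ (permutations (suc r ℕ.* 2)) f
        ≈⟨ ∑-cartesianProductWith (Perm.insert zero) (allFin _) (permutations (suc (r ℕ.* 2))) f ⟩
      ∑ (allFin (suc r ℕ.* 2)) (λ j → ∑ (permutations (suc (r ℕ.* 2))) (f ∘ Perm.insert zero j))
        ≡⟨ ∑-allFin _ (λ j → ∑ (permutations (suc (r ℕ.* 2))) (f ∘ Perm.insert zero j)) ⟩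
      ∑ (permutations (suc (r ℕ.* 2))) (f ∘ Perm.insert zero zero)
        + sum (λ j → ∑ (permutations (suc (r ℕ.* 2))) (f ∘ Perm.insert zero (suc j)))
        ≈⟨ +-congˡ (trans (sum-cong-≋ λ j → ∑-ε (permutations (suc (r ℕ.* 2))) (f-suc j))
             (sum-replicate-zero (suc (r ℕ.* 2)))) ⟩
      ∑ (permutations (suc (r ℕ.* 2))) (f ∘ Perm.insert zero zero) + 0#
        ≈⟨ +-identityʳ _ ⟩
      ∑ (permutations (suc (r ℕ.* 2))) (f ∘ Perm.insert zero zero)
        ≈⟨ ∑-cartesianProductWith (Perm.insert zero) (allFin _) (permutations (r ℕ.* 2)) _ ⟩
      ∑ (allFin (suc (r ℕ.* 2))) (λ k →
        ∑ (permutations (r ℕ.* 2)) (λ π → f (Perm.insert zero zero (Perm.insert zero k π))))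
        ≡⟨ ∑-allFin _ (λ k → ∑ (permutations (r ℕ.* 2))
             (λ π → f (Perm.insert zero zero (Perm.insert zero k π)))) ⟩
      sum (λ k → ∑ (permutations (r ℕ.* 2)) (λ π → f (Perm.insert zero zero (Perm.insert zero k π))))
        ≈⟨ sum-cong-≋ fixed-k ⟩
      sum (λ k → ν ^ toℕ k * (X zero (suc k) * pfaffian r (minor k))) ∎
      where
      f = λ σ → when (inF? (suc r) σ) (term σ)

      f-suc : ∀ j τ → f (Perm.insert zero (suc j) τ) ≈ 0#
      f-suc j τ = reflexive (when-¬ (inF? (suc r) σ)
        (λ σ∈F → contradiction (InF⇒σ0≡0 {r} σ σ∈F) λ ()) (term σ))
        where σ = Perm.insert zero (suc j) τ

      f-insert : ∀ k π → f (Perm.insert zero zero (Perm.insert zero k π)) ≈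
                 (ν ^ toℕ k * X zero (suc k)) * when (inF? r π) (minor-term k π)
      f-insert k π = begin
        when (inF? (suc r) σ) (term σ)
          ≡⟨ when-⇔ (InF-insert {r} k π) (inF? (suc r) σ) (inF? r π) (term σ) ⟩
        when (inF? r π) (term σ)
          ≈⟨ when-cong (inF? r π) (term-insert k π) ⟩
        when (inF? r π) ((ν ^ toℕ k * X zero (suc k)) * minor-term k π)
          ≈⟨ when-*ˡ (inF? r π) _ _ ⟩
        (ν ^ toℕ k * X zero (suc k)) * when (inF? r π) (minor-term k π) ∎
        where
        σ = Perm.insert zero zero (Perm.insert zero k π)
        when-cong : ∀ {p} {P : Set p} (P? : Dec P) {x y} → x ≈ y → when P? x ≈ when P? y
        when-cong P? x≈y with does P?
        ... | true  = x≈y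
        ... | false = refl

      fixed-k : ∀ k →
        ∑ (permutations (r ℕ.* 2)) (λ π → f (Perm.insert zero zero (Perm.insert zero k π))) ≈
        ν ^ toℕ k * (X zero (suc k) * pfaffian r (minor k))
      fixed-k k = begin
        ∑ (permutations (r ℕ.* 2)) (λ π → f (Perm.insert zero zero (Perm.insert zero k π)))
          ≈⟨ ∑-cong (permutations (r ℕ.* 2)) (f-insert k) ⟩
        ∑ (permutations (r ℕ.* 2)) (λ π →
          (ν ^ toℕ k * X zero (suc k)) * when (inF? r π) (minor-term k π))
          ≈⟨ sumOver-*ˡ _ (permutations (r ℕ.* 2)) _ ⟩
        (ν ^ toℕ k * X zero (suc k)) *
          ∑ (permutations (r ℕ.* 2)) (λ π → when (inF? r π) (minor-term k π))
          ≈⟨ *-congˡ (∑-filter (inF? r) (permutations (r ℕ.* 2)) (minor-term k)) ⟨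
        (ν ^ toℕ k * X zero (suc k)) * pfaffian r (minor k)
          ≈⟨ *-assoc _ _ _ ⟩
        ν ^ toℕ k * (X zero (suc k) * pfaffian r (minor k)) ∎

  -- Both sides satisfy the same first-row expansion; a minor of `X` is `X` itself read along a
  -- shorter word.
  pfaffian≈pf : ∀ r (X : Matrix (r ℕ.* 2) (r ℕ.* 2)) → pfaffian r X ≈ pf X (allFin (r ℕ.* 2))
  pfaffian≈pf zero    X = trans (+-identityʳ _) (*-identityˡ 1#)
  pfaffian≈pf (suc r) X = begin
    pfaffian (suc r) X
      ≈⟨ pfaffian-suc {r} X ⟩
    sum (λ k → ν ^ toℕ k * (X zero (suc k) * pfaffian r (minor {r} X k)))
      ≈⟨ sum-cong-≋ (λ k → *-congˡ {ν ^ toℕ k} (*-congˡ {X zero (suc k)} (minor≈pf k))) ⟩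
    sum (λ k → ν ^ toℕ k * (X zero (suc k) * pf X (tabulate (suc ∘ punchIn k))))
      ≈⟨ contract-tabulate (X zero) (pf X) suc ⟨
    contract (X zero) (pf X) (tabulate suc)
      ≈⟨ pf-∷ X zero (tabulate suc) ⟨
    pf X (allFin (suc r ℕ.* 2)) ∎
    where
    minor≈pf : ∀ k → pfaffian r (minor {r} X k) ≈ pf X (tabulate (suc ∘ punchIn k))
    minor≈pf k = begin
      pfaffian r (minor {r} X k)                           ≈⟨ pfaffian≈pf r (minor {r} X k) ⟩
      pf (minor {r} X k) (allFin (r ℕ.* 2))                ≈⟨ pf-map (suc ∘ punchIn k) (λ _ _ → refl) (allFin _) ⟩
      pf X (map (suc ∘ punchIn k) (allFin (r ℕ.* 2)))  ≡⟨ ≡.cong (pf X) (List.map-tabulate id (suc ∘ punchIn k)) ⟩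
      pf X (tabulate (suc ∘ punchIn k))                ∎

  -- Pfaffians of block matrices

  -- In odd order the default value 0 of `Pf` agrees with `pf-odd`.
  Pf≈pf : ∀ {n} (X : Matrix n n) → Pf X ≈ pf X (allFin n)
  Pf≈pf {n} X with 2 ∣? n
  ... | yes (divides r ≡.refl) = pfaffian≈pf r X
  ... | no 2∤n with even⊎odd n
  ...   | inj₁ (k , n≡2k)   = contradiction (divides k n≡2k) 2∤n
  ...   | inj₂ (k , n≡1+2k) = sym (pf-odd X k (allFin n) (≡.trans (List.length-tabulate {n = n} id) n≡1+2k))

  Pf-odd : ∀ {n} (X : Matrix n n) → (∃ λ k → n ≡ suc (k ℕ.* 2)) → Pf X ≈ 0#
  Pf-odd {n} X (k , n≡1+2k) =
    trans (Pf≈pf X) (pf-odd X k (allFin n) (≡.trans (List.length-tabulate {n = n} id) n≡1+2k))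

  -- The blocks are the values of one form `a` along a word that lists the letters of `f` before
  -- those of `g`.
  Pf-block : ∀ {p q} (a : I → I → Carrier) (f : Fin p → I) (g : Fin q → I) {X Y Z W} →
    (∀ x y → X x y ≈ a (f x) (f y)) → (∀ x y → Y x y ≈ a (f x) (g y)) →
    (∀ x y → Z x y ≈ a (g x) (f y)) → (∀ x y → W x y ≈ a (g x) (g y)) →
    Pf (block X Y Z W) ≈ pf a (tabulate f ++ tabulate g)
  Pf-block {p = p} {q} a f g {X} {Y} {Z} {W} X≈ Y≈ Z≈ W≈ = begin
    Pf (block X Y Z W)                    ≈⟨ Pf≈pf (block X Y Z W) ⟩
    pf (block X Y Z W) (allFin (p ℕ.+ q)) ≈⟨ pf-map h entry (allFin (p ℕ.+ q)) ⟩
    pf a (map h (allFin (p ℕ.+ q)))       ≡⟨ ≡.cong (pf a) (List.map-tabulate {n = p ℕ.+ q} id h) ⟩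
    pf a (tabulate h)                     ≡⟨ ≡.cong (pf a) (tabulate-splitAt p f g) ⟩
    pf a (tabulate f ++ tabulate g)       ∎
    where
    h = [ f , g ]′ ∘ splitAt p

    entry : ∀ i j → block X Y Z W i j ≈ a (h i) (h j)
    entry i j with splitAt p i
    entry i j | inj₁ x with splitAt p j
    ... | inj₁ y = X≈ x y
    ... | inj₂ y = Y≈ x y
    entry i j | inj₂ x with splitAt p j
    ... | inj₁ y = Z≈ x y
    ... | inj₂ y = W≈ x y

  -- The alphabet contains all `l` columns, so that a single form serves every `K`, and choosing `K`
  -- means choosing a word.
  bordered : ∀ {p l} → Matrix p p → Matrix p l → Fin p ⊎ Fin l → Fin p ⊎ Fin l → Carrier
  bordered X Y (inj₁ x) (inj₁ y) = X x y
  bordered X Y (inj₁ x) (inj₂ k) = Y x k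
  bordered X Y (inj₂ k) (inj₁ x) = - Y x k
  bordered X Y (inj₂ _) (inj₂ _) = 0#

  bordered-skew : ∀ {p l} {X : Matrix p p} (Y : Matrix p l) → IsSkewSymmetric X → Skew (bordered X Y)
  bordered-skew Y (skew , _) (inj₁ x) (inj₁ y) = trans (skew y x) (sym (-1*x≈-x _))
  bordered-skew Y _          (inj₁ x) (inj₂ k) =
    sym (trans (-1*x≈-x _) (RingProperties.-‿involutive ring _))
  bordered-skew Y _          (inj₂ k) (inj₁ x) = sym (-1*x≈-x _)
  bordered-skew Y _          (inj₂ _) (inj₂ _) = sym (zeroʳ ν)

  PfBordered : ∀ {p l} → Matrix p p → Matrix p l → Subset l → Carrier
  PfBordered X Y K = Pf (block X (columns Y K) (⊝ transpose (columns Y K)) O)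

  PfBordered≈pf : ∀ {p l} (X : Matrix p p) (Y : Matrix p l) K →
    PfBordered X Y K ≈ pf (bordered X Y) (tabulate inj₁ ++ tabulate (inj₂ ∘ element K))
  PfBordered≈pf X Y K = Pf-block (bordered X Y) inj₁ (inj₂ ∘ element K)
    (λ _ _ → refl) (λ _ _ → refl) (λ _ _ → refl) (λ _ _ → refl)

  -- The induction on `l` runs over all subsets; this returns to the sum in the theorem.
  sumOver-parity : ∀ l m {F : Subset l → Carrier} → (∀ K → ∣ K ∣ % 2 ≢ m % 2 → F K ≈ 0#) →
                   sumOver (subsetsOfParity l m) F ≈ sumOver (subsets l) F
  sumOver-parity l m {F} F≈0 = trans (∑-filter (λ K → ∣ K ∣ % 2 ℕ.≟ m % 2) (subsets l) F)
    (∑-cong (subsets l) λ K → drop-when (∣ K ∣ % 2 ℕ.≟ m % 2) (F≈0 K))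
    where
    drop-when : ∀ {p} {P : Set p} (P? : Dec P) {x} → (¬ P → x ≈ 0#) → when P? x ≈ x
    drop-when (yes _) _   = refl
    drop-when (no ¬P) x≈0 = sym (x≈0 ¬P)

  -- From words back to the matrices of the theorem

  module _ {m n l} {A : Matrix m m} {B : Matrix n n}
           (A-skew : IsSkewSymmetric A) (B-skew : IsSkewSymmetric B)
           (S : Matrix m l) (T : Matrix n l)
    where

    -- The two identities of the theorem are the cases e = 1 and e = -1.
    sum-Pf*Pf : ∀ {e} → e * e ≈ 1# → {B′ : Matrix n n} → (∀ x y → B′ x y ≈ e * B x y) →
      sumOver (subsetsOfParity l m)
        (λ K → (ν * e) ^ (∣ K ∣ C 2) * PfBordered A S K * PfBordered B T K)
      ≈ e ^ (n C 2) * Pf (block A (S ⊛ transpose T) (⊝ (T ⊛ transpose S)) B′)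
    sum-Pf*Pf {e} ee≈1 {B′} B′≈eB = begin
      sumOver (subsetsOfParity l m)
        (λ K → (ν * e) ^ (∣ K ∣ C 2) * PfBordered A S K * PfBordered B T K)
        ≈⟨ sumOver-parity l m wrong-parity ⟩
      sumOver (subsets l) (λ K → (ν * e) ^ (∣ K ∣ C 2) * PfBordered A S K * PfBordered B T K)
        ≈⟨ ∑-cong (subsets l) (λ K →
             *-cong (*-congˡ (PfBordered≈pf A S K)) (PfBordered≈pf B T K)) ⟩
      sumOver (subsets l) (summand skewA skewB ee≈1 inj₂ inj₂ w w′)
        -- Isotropy holds by computation: `bordered` is `0#` between column letters.
        ≈⟨ sum-pf*pf≈pf-glue skewA skewB ee≈1 inj₂ inj₂ (λ _ _ → refl) (λ _ _ → refl) w w′ ⟩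
      e ^ (length w′ C 2) * pf G (map inj₁ w ++ map inj₂ w′)
        ≡⟨ ≡.cong₂ (λ k us → e ^ (k C 2) * pf G us) (List.length-tabulate {n = n} inj₁)
             (≡.cong₂ _++_ (List.map-tabulate {n = m} inj₁ inj₁) (List.map-tabulate {n = n} inj₁ inj₂)) ⟩
      e ^ (n C 2) * pf G (tabulate (inj₁ ∘ inj₁) ++ tabulate (inj₂ ∘ inj₁))
        -- On row letters `cross` computes to the entries of `S ⊛ transpose T`; only the two lower
        -- blocks need an argument.
        ≈⟨ *-congˡ (Pf-block G (inj₁ ∘ inj₁) (inj₂ ∘ inj₁)
             (λ _ _ → refl) (λ _ _ → refl) lower-left B′≈eB) ⟨
      e ^ (n C 2) * Pf (block A (S ⊛ transpose T) (⊝ (T ⊛ transpose S)) B′) ∎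
      where
      skewA = bordered-skew S A-skew
      skewB = bordered-skew T B-skew
      G     = glue skewA skewB ee≈1 {l} inj₂ inj₂

      w : List (Fin m ⊎ Fin l)
      w = tabulate inj₁

      w′ : List (Fin n ⊎ Fin l)
      w′ = tabulate inj₁

      lower-left : ∀ y x → (⊝ (T ⊛ transpose S)) y x ≈ ν * sum (λ k → S x k * T y k)
      lower-left y x = trans (sym (-1*x≈-x _)) (*-congˡ (sum-cong-≋ λ k → *-comm (T y k) (S x k)))

      wrong-parity : ∀ K → ∣ K ∣ % 2 ≢ m % 2 →
                     (ν * e) ^ (∣ K ∣ C 2) * PfBordered A S K * PfBordered B T K ≈ 0#
      -- The bordered matrix of `A` has order `m + ∣ K ∣`, which is odd here.
      wrong-parity K k≢m = trans (*-congʳ (trans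
        (*-congˡ (Pf-odd _ (%2-cases m ∣ K ∣ k≢m))) (zeroʳ _))) (zeroˡ _)

  1^n≈1 : ∀ n → 1# ^ n ≈ 1#
  1^n≈1 zero    = refl
  1^n≈1 (suc n) = trans (*-identityˡ _) (1^n≈1 n)

theorem3p2 : ∀ {c ℓ} (R : CommutativeRing c ℓ) →
    let open CommutativeRing R
        open Pfaffians R
    in
    ∀ (m n l : ℕ) → m % 2 ≡ n % 2 →
    ∀ (A : Matrix m m) (B : Matrix n n) →
    IsSkewSymmetric A → IsSkewSymmetric B →
    ∀ (S : Matrix m l) (T : Matrix n l) →
    (sumOver (subsetsOfParity l m) (λ K →
        (- 1#) ^ (∣ K ∣ C 2)
        * Pf (block A (columns S K) (⊝ transpose (columns S K)) O)
        * Pf (block B (columns T K) (⊝ transpose (columns T K)) O))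
      ≈ Pf (block A (S ⊛ transpose T) (⊝ (T ⊛ transpose S)) B))
    ×
    (sumOver (subsetsOfParity l m) (λ K →
        Pf (block A (columns S K) (⊝ transpose (columns S K)) O)
        * Pf (block B (columns T K) (⊝ transpose (columns T K)) O))
      ≈ (- 1#) ^ (n C 2)
        * Pf (block A (S ⊛ transpose T) (⊝ (T ⊛ transpose S)) (⊝ B)))
theorem3p2 R m n l _ A B A-skew B-skew S T = first , second
  where
  open CommutativeRing R hiding (zero)
  open Pfaffians R
  open ListSum +-monoid using (∑-cong)
  open WordPfaffian R
  open CommutativeSemiringExp commutativeSemiring using (^-congˡ)

  Ks = subsetsOfParity l m

  -- The case e = 1: the base `ν * 1#` is `ν`, and the outer sign is a power of 1.
  first = trans
    (∑-cong Ks λ K → *-congʳ (*-congʳ (^-congˡ (∣ K ∣ C 2) (sym (*-identityʳ ν)))))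
    (trans (sum-Pf*Pf A-skew B-skew S T (*-identityˡ 1#) {B} (λ _ _ → sym (*-identityˡ _)))
           (trans (*-congʳ (1^n≈1 (n C 2))) (*-identityˡ _)))

  -- The case e = `ν`: the base `ν * ν` is 1, so the sign inside the sum disappears, while the outer
  -- one stays.
  second = trans
    (∑-cong Ks λ K → *-congʳ (sym (trans
      (*-congʳ (trans (^-congˡ (∣ K ∣ C 2) νν≈1) (1^n≈1 (∣ K ∣ C 2)))) (*-identityˡ _))))
    (sum-Pf*Pf A-skew B-skew S T νν≈1 {⊝ B} (λ _ _ → sym (-1*x≈-x _)))
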